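{- Let $m\geqslant 2$, let $\mu\subseteq\lambda$ be partitions and $1\leqslant k<m$. For every $T\in\mathsf{SVT}^m(\lambda/\mu)$ we have $\mathsf{res}(f_k(T))=f^\star_k(\mathsf{res}(T))$ and $\mathsf{res}(e_k(T))=e^\star_k(\mathsf{res}(T))$, with the convention $\mathsf{res}(0)=0$ (so in particular $f_k(T)=0$ if and only if $f^\star_k(\mathsf{res}(T))=0$, and similarly for $e_k$).
   Context: Tableaux are in French notation; cell $(i,j)$ lies in row $i$ (from the bottom) and column $j$. $\mathsf{SVT}^m(\lambda/\mu)$ is the set of fillings of the cells of $\lambda/\mu$ by nonempty subsets of $[m]$ with $\max(A)\leqslant\min(B)$ for horizontally adjacent cells $A$ left of $B$ and $\max(A)<\min(C)$ for vertically adjacent cells $A$ below $C$. Crystal on $\mathsf{SVT}^m(\lambda/\mu)$: assign $-$ to each column containing $k$ but not $k+1$, and $+$ to each column containing $k+1$ but not $k$; successively pair each $+$ with an adjacent $-$ to its right (ignoring paired signs) until no more pairs form. If no unpaired $-$ exists, $f_k(T)=0$; else let $b$ be the cell with the $k$ in the rightmost column carrying an unpaired $-$; if the cell $b^\rightarrow$ right of $b$ contains both $k$ and $k+1$, remove $k$ from $b^\rightarrow$ and add $k+1$ to $b$, otherwise change that $k$ in $b$ into $k+1$. If no unpaired $+$ exists, $e_k(T)=0$; else let $b$ be the cell with the $k+1$ in the leftmost column carrying an unpaired $+$; if the cell $b^\leftarrow$ left of $b$ contains both $k$ and $k+1$, remove $k+1$ from $b^\leftarrow$ and add $k$ to $b$,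 otherwise change that $k+1$ into $k$. Residue map: the content of cell $(i,j)$ of $\lambda/\mu$ is $\ell(\lambda)+j-i$ ($\ell(\lambda)$ = number of parts); $\mathsf{res}(T)=h^m\cdots h^1$ where $h^a$ is the decreasing list of contents of the cells containing $a$. Its image lies in $\mathcal{H}^{m,\star}$: the set of decreasing factorizations $h^m\cdots h^1$ (each $h^a$ a possibly empty strictly decreasing word of positive integers) whose product is fully-commutative in the 0-Hecke monoid (words modulo $pq=qp$ for $|p-q|>1$, $pqp=qpq$, $pp=p$; fully-commutative means no equivalent reduced word contains $i(i+1)i$ or $i(i-1)i$ consecutively). $\star$-crystal on $\mathcal{H}^{m,\star}$: pair letters $b$ of $h^{k+1}$, in decreasing order, each with the smallest not-yet-paired letter $a\geqslant b$ of $h^k$ if one exists. If all letters of $h^k$ are paired, $f^\star_k=0$; else with $x$ the largest unpaired letter of $h^k$: if $x+1\in h^k\cap h^{k+1}$, remove $x+1$ from $h^k$ and add $x$ to $h^{k+1}$; otherwise move $x$ from $h^k$ to $h^{k+1}$. If all letters of $h^{k+1}$ are paired, $e^\star_k=0$; else with $y$ the smallest unpaired letter of $h^{k+1}$: if $y-1\in h^k\cap h^{k+1}$, remove $y-1$ from $h^{k+1}$ and add $y$ to $h^k$; otherwise move $y$ from $h^{k+1}$ to $h^k$. -}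

module Defs where

open import Data.Nat.Base
open import Data.Bool.Base using (Bool; true; false; _∧_; _∨_; not; if_then_else_)
open import Data.List.Base using (List; []; _∷_; length; map; concatMap; applyUpTo; filterᵇ; findᵇ; reverse; foldl)
open import Data.Bool.ListAction using (any)
open import Data.List.Relation.Unary.All using (All)
open import Data.List.Relation.Unary.Linked using (Linked)
open import Data.Maybe.Base using (Maybe; just; nothing)
open import Data.Product.Base using (_×_; _,_; Σ; ∃)
open import Relation.Binary.PropositionalEquality using (_≡_)

range : ℕ → ℕ → List ℕ
range a b = applyUpTo (λ t → a + t) (suc b ∸ a)

nth : {A : Set} → A → List A → ℕ → A
nth d []       _       = d
nth d (x ∷ xs) zero    = x
nth d (x ∷ xs) (suc n) = nth d xs n

setAt : {A : Set} → ℕ → A → List A → List A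
setAt _       _ []       = []
setAt zero    a (x ∷ xs) = a ∷ xs
setAt (suc n) a (x ∷ xs) = x ∷ setAt n a xs

IsPartition : List ℕ → Set
IsPartition la = All (λ p → 1 ≤ p) la × Linked _≥_ la

-- i-th part, 1-indexed (0 beyond the length)
part : List ℕ → ℕ → ℕ
part la i = nth 0 la (i ∸ 1)

_⊆ₚ_ : List ℕ → List ℕ → Set
mu ⊆ₚ la = length mu ≤ length la × (∀ i → part mu i ≤ part la i)

-- cell (i , j) : row i (from bottom), column j, French notation
inShapeᵇ : List ℕ → List ℕ → ℕ → ℕ → Bool
inShapeᵇ la mu i j = (1 ≤ᵇ i) ∧ (i ≤ᵇ length la) ∧ (part mu i <ᵇ j) ∧ (j ≤ᵇ part la i)

InShape : List ℕ → List ℕ → ℕ → ℕ → Set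
InShape la mu i j = inShapeᵇ la mu i j ≡ true

rows : List ℕ → List ℕ
rows la = range 1 (length la)

columns : List ℕ → List ℕ
columns la = range 1 (part la 1)

cells : List ℕ → List ℕ → List (ℕ × ℕ)
cells la mu = concatMap (λ i → map (λ j → (i , j)) (range (suc (part mu i)) (part la i))) (rows la)

content : List ℕ → ℕ × ℕ → ℕ
content la (i , j) = length la + j ∸ i

-- Set-valued tableaux: T i j a = true iff a is in the entry of cell (i , j)

Tableau : Set
Tableau = ℕ → ℕ → ℕ → Bool

IsSVT : ℕ → List ℕ → List ℕ → Tableau → Set
IsSVT m la mu T =
    (∀ i j a → T i j a ≡ true → InShape la mu i j)
  × (∀ i j a → T i j a ≡ true → 1 ≤ a × a ≤ m)
  × (∀ i j → InShape la mu i j → ∃ λ a → T i j a ≡ true)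
  × (∀ i j a b → InShape la mu i j → InShape la mu i (suc j) →
       T i j a ≡ true → T i (suc j) b ≡ true → a ≤ b)
  × (∀ i j a b → InShape la mu i j → InShape la mu (suc i) j →
       T i j a ≡ true → T (suc i) j b ≡ true → a < b)

setEntry : Tableau → ℕ → ℕ → ℕ → Bool → Tableau
setEntry T i j a v i' j' a' =
  if (i' ≡ᵇ i) ∧ (j' ≡ᵇ j) ∧ (a' ≡ᵇ a) then v else T i' j' a'

colHas : List ℕ → List ℕ → Tableau → ℕ → ℕ → Bool
colHas la mu T j a = any (λ i → inShapeᵇ la mu i j ∧ T i j a) (rows la)

findRow : List ℕ → List ℕ → Tableau → ℕ → ℕ → Maybe ℕ
findRow la mu T j a = findᵇ (λ i → inShapeᵇ la mu i j ∧ T i j a) (rows la)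

isMinus isPlus : List ℕ → List ℕ → Tableau → ℕ → ℕ → Bool
isMinus la mu T k j = colHas la mu T j k ∧ not (colHas la mu T j (suc k))
isPlus  la mu T k j = colHas la mu T j (suc k) ∧ not (colHas la mu T j k)

-- bracketing, left to right: (#open unpaired +, rightmost unpaired − so far)
fScan : List ℕ → List ℕ → Tableau → ℕ → ℕ × Maybe ℕ → ℕ → ℕ × Maybe ℕ
fScan la mu T k (o , c) j with isMinus la mu T k j | isPlus la mu T k j
... | true  | _    with o
...   | zero  = (zero , just j)
...   | suc o' = (o' , c)
fScan la mu T k (o , c) j | false | true  = (suc o , c)
fScan la mu T k (o , c) j | false | false = (o , c)

-- bracketing, right to left: (#open unpaired −, leftmost unpaired + so far)
eScan : List ℕ → List ℕ → Tableau → ℕ → ℕ × Maybe ℕ → ℕ → ℕ × Maybe ℕ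
eScan la mu T k (o , c) j with isPlus la mu T k j | isMinus la mu T k j
... | true  | _    with o
...   | zero  = (zero , just j)
...   | suc o' = (o' , c)
eScan la mu T k (o , c) j | false | true  = (suc o , c)
eScan la mu T k (o , c) j | false | false = (o , c)

snd : {A B : Set} → A × B → B
snd (_ , b) = b

-- crystal operators on SVT; nothing represents 0
fTab : List ℕ → List ℕ → ℕ → Tableau → Maybe Tableau
fTab la mu k T with snd (foldl (fScan la mu T k) (0 , nothing) (columns la))
... | nothing = nothing
... | just j with findRow la mu T j k
...   | nothing = nothing
...   | just i =
  if inShapeᵇ la mu i (suc j) ∧ T i (suc j) k ∧ T i (suc j) (suc k)
  then just (setEntry (setEntry T i (suc j) k false) i j (suc k) true)
  else just (setEntry (setEntry T i j k false) i j (suc k) true)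

eTab : List ℕ → List ℕ → ℕ → Tableau → Maybe Tableau
eTab la mu k T with snd (foldl (eScan la mu T k) (0 , nothing) (reverse (columns la)))
... | nothing = nothing
... | just j with findRow la mu T j (suc k)
...   | nothing = nothing
...   | just i =
  if (2 ≤ᵇ j) ∧ inShapeᵇ la mu i (j ∸ 1) ∧ T i (j ∸ 1) k ∧ T i (j ∸ 1) (suc k)
  then just (setEntry (setEntry T i (j ∸ 1) (suc k) false) i j k true)
  else just (setEntry (setEntry T i j (suc k) false) i j k true)

-- Decreasing factorizations, stored as the list [h^1 , h^2 , … , h^m]

Factorization : Set
Factorization = List (List ℕ)

hword : List ℕ → List ℕ → Tableau → ℕ → List ℕ
hword la mu T a =
  filterᵇ (λ c → any (λ ij → (content la ij ≡ᵇ c) ∧ T (fstc ij) (sndc ij) a) (cells la mu))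
          (reverse (range 1 (length la + part la 1)))
  where
  fstc sndc : ℕ × ℕ → ℕ
  fstc (i , _) = i
  sndc (_ , j) = j

res : ℕ → List ℕ → List ℕ → Tableau → Factorization
res m la mu T = map (hword la mu T) (range 1 m)

resM : ℕ → List ℕ → List ℕ → Maybe Tableau → Maybe Factorization
resM m la mu nothing  = nothing
resM m la mu (just T) = just (res m la mu T)

_∈ᵇ_ : ℕ → List ℕ → Bool
x ∈ᵇ xs = any (λ y → y ≡ᵇ x) xs

remove : ℕ → List ℕ → List ℕ
remove x = filterᵇ (λ y → not (y ≡ᵇ x))

insertDec : ℕ → List ℕ → List ℕ
insertDec x []       = x ∷ []
insertDec x (y ∷ ys) = if y <ᵇ x then x ∷ y ∷ ys
                       else if y ≡ᵇ x then y ∷ ys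
                       else y ∷ insertDec x ys

minL maxL : List ℕ → Maybe ℕ
minL []       = nothing
minL (x ∷ xs) with minL xs
... | nothing = just x
... | just y  = just (x ⊓ y)
maxL []       = nothing
maxL (x ∷ xs) with maxL xs
... | nothing = just x
... | just y  = just (x ⊔ y)

-- pairing: (unpaired letters of h^k , unpaired letters of h^{k+1})
pairStep : List ℕ × List ℕ → ℕ → List ℕ × List ℕ
pairStep (avail , unp) b with minL (filterᵇ (λ a → b ≤ᵇ a) avail)
... | just a  = (remove a avail , unp)
... | nothing = (avail , b ∷ unp)

pairing : List ℕ → List ℕ → List ℕ × List ℕ
pairing hk hk1 = foldl pairStep (hk , []) hk1   -- hk1 read in decreasing order

fstL : {A B : Set} → A × B → A
fstL (a , _) = a

fStar : ℕ → Factorization → Maybe Factorization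
fStar k h with maxL (fstL (pairing (nth [] h (k ∸ 1)) (nth [] h k)))
... | nothing = nothing
... | just x =
  let hk  = nth [] h (k ∸ 1)
      hk1 = nth [] h k
  in if (suc x ∈ᵇ hk) ∧ (suc x ∈ᵇ hk1)
     then just (setAt (k ∸ 1) (remove (suc x) hk) (setAt k (insertDec x hk1) h))
     else just (setAt (k ∸ 1) (remove x hk) (setAt k (insertDec x hk1) h))

eStar : ℕ → Factorization → Maybe Factorization
eStar k h with minL (snd (pairing (nth [] h (k ∸ 1)) (nth [] h k)))
... | nothing = nothing
... | just y =
  let hk  = nth [] h (k ∸ 1)
      hk1 = nth [] h k
  in if (1 ≤ᵇ y) ∧ ((y ∸ 1) ∈ᵇ hk) ∧ ((y ∸ 1) ∈ᵇ hk1)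
     then just (setAt (k ∸ 1) (insertDec y hk) (setAt k (remove (y ∸ 1) hk1) h))
     else just (setAt (k ∸ 1) (insertDec y hk) (setAt k (remove y hk1) h))

{-# OPTIONS --safe #-}
module Submission where

-- For a word in + and −, let the height of a prefix be #− minus #+. The last
-- unmatched − sits where the height first reaches its maximum, and the first
-- unmatched + right after the place where it last does. Reading the k's (−) and
-- k+1's (+) of T by columns gives the signature of the tableau crystal; reading
-- them by contents, + before − on each diagonal, gives the pairing of the
-- ⋆-crystal. Cells with entry k form a horizontal strip, so columns and contents
-- order them alike, and likewise for k+1; a k and a k+1 are ordered differently
-- only inside a two-row block of k's below k+1's, where the column word +−+−…+−
-- becomes ++−+−…−−. Hence the content height never exceeds the column height,
-- and the two agree at the extremal maxima, so both crystals select the same cell.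

open import Defs
open import Data.Bool.Base using (Bool; true; false; _∧_; not; if_then_else_; T)
open import Data.Bool.ListAction using (any)
open import Data.Bool.Properties using (T-≡; T?; ∨-zeroʳ)
open import Data.Empty using (⊥)
open import Data.Integer.Base as ℤ using (ℤ; _⊖_; +_)
import Data.Integer.Properties as ℤₚ
open import Data.List.Base using (List; []; _∷_; _++_; length;
  foldl; filterᵇ; findᵇ; map; reverse; applyUpTo; applyDownFrom)
open import Data.List.Membership.Propositional using (_∈_; _∉_; lose; find)
open import Data.List.Membership.Propositional.Properties
  using (∈-filter⁺; ∈-filter⁻; ∈-++⁺ˡ; ∈-++⁺ʳ; ∈-++⁻; ∈-applyUpTo⁺;
         ∈-applyUpTo⁻; ∈-concatMap⁺; ∈-concatMap⁻; ∈-map⁺; ∈-map⁻)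
open import Data.List.Properties
  using (applyUpTo-∷ʳ; foldl-∷ʳ; reverse-applyUpTo; map-applyUpTo; ++-identityʳ)
open import Data.List.Relation.Unary.All as All using (All; []; _∷_)
open import Data.List.Relation.Unary.AllPairs using (AllPairs; []; _∷_)
import Data.List.Relation.Unary.AllPairs.Properties as AllPairsₚ
open import Data.List.Relation.Unary.Any using (here; there)
open import Data.List.Relation.Unary.Any.Properties using (reverse⁺; reverse⁻)
open import Data.List.Relation.Unary.Linked using (Linked; _∷_)
open import Data.Maybe.Base using (Maybe; just; nothing)
open import Data.Nat.Base
open import Data.Nat.Properties
open import Data.Product.Base using (_×_; _,_; ∃; ∃₂; proj₁; proj₂)
open import Data.Sum.Base using (_⊎_; inj₁; inj₂; [_,_]′)
open import Function.Base using (_∘_; case_of_)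
open import Function.Bundles using (Equivalence)
open import Relation.Binary.Definitions using (tri<; tri≈; tri>)
open import Relation.Binary.PropositionalEquality
open import Relation.Nullary using (¬_; Dec; yes; no; contradiction)
open import Relation.Nullary.Decidable using (map′; _⊎-dec_)

-- One crystal brackets by a scan, the other by a greedy search for the smallest free letter. The
-- extremal maxima of a height are unique, so it is enough that both procedures find them. In the
-- greedy search each step deletes a pair and thereby changes the height, but only strictly inside a
-- level stretch of the new height; so the extremal maxima of the remaining word are those of the
-- word before the step. Columns and contents are different scales, so the heights cannot be
-- compared point by point. Each content prefix is dominated by some column prefix, and equality is
-- required only at the selected cell. It holds there because the column of an unmatched - has no
-- k+1 and that of an unmatched + has no k, while every pair of letters whose order changes puts the
-- excluded letter into that column. The same exclusion decides the branches: a content shared by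
-- both words next to the selected letter must come from one neighbouring cell, since otherwise a
-- block would reach back into the selected column.

-- Heights of sign words and their extremal maxima

count : (ℕ → Bool) → ℕ → ℕ
count p zero    = 0
count p (suc n) = (if p (suc n) then 1 else 0) + count p n

-- Integer-valued, since a prefix may hold more + than -. Position 0 is the empty prefix; letters
-- sit at positions from 1 on.
height : (p q : ℕ → Bool) → ℕ → ℤ
height p q n = count p n ⊖ count q n

count-step : ∀ p n → count p n ≤ count p (suc n)
count-step p n = m≤n+m _ _

count-mono : ∀ p {m n} → m ≤ n → count p m ≤ count p n
count-mono p {m} {n} m≤n with ≤⇒≤′ m≤n
... | ≤′-refl = ≤-refl
... | ≤′-step {n′} m≤′n = ≤-trans (count-mono p (≤′⇒≤ m≤′n)) (count-step p n′)

count-true : ∀ p n → p (suc n) ≡ true → count p (suc n) ≡ suc (count p n)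
count-true p n e rewrite e = refl

count-false : ∀ p n → p (suc n) ≡ false → count p (suc n) ≡ count p n
count-false p n e rewrite e = refl

count-cong : ∀ p p′ n → (∀ i → i ≤ n → p i ≡ p′ i) → count p n ≡ count p′ n
count-cong p p′ zero    h = refl
count-cong p p′ (suc n) h
  rewrite h (suc n) ≤-refl | count-cong p p′ n (λ i i≤n → h i (m≤n⇒m≤1+n i≤n)) = refl

count-const : ∀ p {m n} → m ≤ n → (∀ i → m < i → i ≤ n → p i ≡ false) → count p n ≡ count p m
count-const p {m} {n} m≤n h with ≤⇒≤′ m≤n
... | ≤′-refl = refl
... | ≤′-step {n′} m≤′n = trans (count-false p n′ (h (suc n′) (s≤s (≤′⇒≤ m≤′n)) ≤-refl))
        (count-const p (≤′⇒≤ m≤′n) (λ i m<i i≤n → h i m<i (m≤n⇒m≤1+n i≤n)))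

count-remove : ∀ p p′ {a n} → 1 ≤ a → a ≤ n → p a ≡ true → p′ a ≡ false →
               (∀ i → i ≢ a → p i ≡ p′ i) → count p n ≡ suc (count p′ n)
count-remove p p′ {suc a} {suc n} _ (s≤s a≤n) pa p′a same with m≤n⇒m<n∨m≡n a≤n
... | inj₂ refl rewrite pa | p′a =
      cong suc (count-cong p p′ a (λ i i≤a → same i (<⇒≢ (s≤s i≤a))))
... | inj₁ a<n rewrite same (suc n) (≢-sym (<⇒≢ (s≤s a<n))) | count-remove p p′ (s≤s z≤n) a<n pa p′a same =
      +-suc _ _

height-mono : ∀ {p q p′ q′ m n} → count p m ≤ count p′ n → count q′ n ≤ count q m →
              height p q m ℤ.≤ height p′ q′ n
height-mono {p} {q} {p′} {q′} {m} {n} h₁ h₂ =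
  ℤₚ.≤-trans (ℤₚ.⊖-monoˡ-≤ (count q m) h₁) (ℤₚ.⊖-monoʳ-≥-≤ (count p′ n) h₂)

height-cong : ∀ {p q p′ q′ m n} → count p m ≡ count p′ n → count q m ≡ count q′ n →
              height p q m ≡ height p′ q′ n
height-cong = cong₂ _⊖_

record FirstArgmax (D : ℕ → ℤ) (N x : ℕ) : Set where
  constructor firstArgmax
  field
    bound  : x ≤ N
    strict : ∀ {c} → c < x → D c ℤ.< D x
    weak   : ∀ {c} → c ≤ N → D c ℤ.≤ D x

-- The lower end M varies because a right-to-left scan has seen only a final segment.
record LastArgmax (D : ℕ → ℤ) (M N z : ℕ) : Set where
  constructor lastArgmax
  field
    lower  : M ≤ z
    bound  : z ≤ N
    strict : ∀ {c} → z < c → c ≤ N → D c ℤ.< D z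
    weak   : ∀ {c} → M ≤ c → c ≤ N → D c ℤ.≤ D z

firstArgmax-unique : ∀ {D N x y} → FirstArgmax D N x → FirstArgmax D N y → x ≡ y
firstArgmax-unique {x = x} {y} (firstArgmax bx sx wx) (firstArgmax by sy wy) with <-cmp x y
... | tri< x<y _ _ = contradiction (wx by) (ℤₚ.<⇒≱ (sy x<y))
... | tri≈ _ e _   = e
... | tri> _ _ y<x = contradiction (wy bx) (ℤₚ.<⇒≱ (sx y<x))

lastArgmax-unique : ∀ {D M N x y} → LastArgmax D M N x → LastArgmax D M N y → x ≡ y
lastArgmax-unique {x = x} {y} (lastArgmax lx bx sx wx) (lastArgmax ly by sy wy) with <-cmp x y
... | tri< x<y _ _ = contradiction (wy lx bx) (ℤₚ.<⇒≱ (sx x<y by))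
... | tri≈ _ e _   = e
... | tri> _ _ y<x = contradiction (wx ly by) (ℤₚ.<⇒≱ (sy y<x bx))

-- The last unmatched − is the first place where the height is maximal, and the
-- first unmatched + comes right after the last such place.
data LastMinus (D : ℕ → ℤ) (N : ℕ) : Maybe ℕ → Set where
  none : FirstArgmax D N 0 → LastMinus D N nothing
  some : ∀ {x} → FirstArgmax D N (suc x) → LastMinus D N (just (suc x))

data FirstPlus (D : ℕ → ℤ) (M N : ℕ) : Maybe ℕ → Set where
  none : LastArgmax D M N N → FirstPlus D M N nothing
  some : ∀ {z} → z < N → LastArgmax D M N z → FirstPlus D M N (just (suc z))

lastMinus-unique : ∀ {D N u v} → LastMinus D N u → LastMinus D N v → u ≡ v
lastMinus-unique (none _) (none _) = refl
lastMinus-unique (none a) (some b) with () ← firstArgmax-unique a b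
lastMinus-unique (some a) (none b) with () ← firstArgmax-unique a b
lastMinus-unique (some a) (some b) = cong just (firstArgmax-unique a b)

firstPlus-unique : ∀ {D M N u v} → FirstPlus D M N u → FirstPlus D M N v → u ≡ v
firstPlus-unique (none _)   (none _)   = refl
firstPlus-unique (none a)   (some l b) = contradiction (sym (lastArgmax-unique a b)) (<⇒≢ l)
firstPlus-unique (some l a) (none b)   = contradiction (lastArgmax-unique a b) (<⇒≢ l)
firstPlus-unique (some _ a) (some _ b) = cong (just ∘ suc) (lastArgmax-unique a b)

height-up : ∀ p q n → p (suc n) ≡ true → q (suc n) ≡ false →
            height p q (suc n) ≡ ℤ.suc (height p q n)
height-up p q n e e′ rewrite e | e′ = sym (ℤₚ.distribʳ-⊖-+-pos 1 (count p n) (count q n))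

height-down : ∀ p q n → p (suc n) ≡ false → q (suc n) ≡ true →
              height p q n ≡ ℤ.suc (height p q (suc n))
height-down p q n e e′ rewrite e | e′ =
  trans (sym (ℤₚ.[1+m]⊖[1+n]≡m⊖n (count p n) (count q n)))
        (sym (ℤₚ.distribʳ-⊖-+-pos 1 (count p n) (suc (count q n))))

height-flat : ∀ p q n → p (suc n) ≡ q (suc n) → height p q (suc n) ≡ height p q n
height-flat p q n e rewrite e with q (suc n)
... | true  = ℤₚ.[1+m]⊖[1+n]≡m⊖n (count p n) (count q n)
... | false = refl

i<suc[i] : ∀ i → i ℤ.< ℤ.suc i
i<suc[i] i = ℤₚ.suc[i]≤j⇒i<j ℤₚ.≤-refl

firstArgmax-extend : ∀ {D n x} → FirstArgmax D n x → D (suc n) ℤ.≤ D x → FirstArgmax D (suc n) x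
firstArgmax-extend {D} {n} {x} (firstArgmax b s w) h = firstArgmax (m≤n⇒m≤1+n b) s w′
  where
  w′ : ∀ {c} → c ≤ suc n → D c ℤ.≤ D x
  w′ c≤ with m≤n⇒m<n∨m≡n c≤
  ... | inj₁ (s≤s c≤n) = w c≤n
  ... | inj₂ refl      = h

firstArgmax-new : ∀ {D n x} → FirstArgmax D n x → D x ℤ.< D (suc n) → FirstArgmax D (suc n) (suc n)
firstArgmax-new {D} {n} {x} (firstArgmax b s w) h = firstArgmax ≤-refl s′ w′
  where
  s′ : ∀ {c} → c < suc n → D c ℤ.< D (suc n)
  s′ (s≤s c≤n) = ℤₚ.≤-<-trans (w c≤n) h
  w′ : ∀ {c} → c ≤ suc n → D c ℤ.≤ D (suc n)
  w′ c≤ with m≤n⇒m<n∨m≡n c≤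
  ... | inj₁ c<   = ℤₚ.<⇒≤ (s′ c<)
  ... | inj₂ refl = ℤₚ.≤-refl

lastArgmax-extend : ∀ {D n N z} → LastArgmax D (suc n) N z → D n ℤ.≤ D z → LastArgmax D n N z
lastArgmax-extend {D} {n} {N} {z} (lastArgmax l b s w) h = lastArgmax (<⇒≤ l) b s w′
  where
  w′ : ∀ {c} → n ≤ c → c ≤ N → D c ℤ.≤ D z
  w′ n≤ c≤N with m≤n⇒m<n∨m≡n n≤
  ... | inj₁ n<c  = w n<c c≤N
  ... | inj₂ refl = h

lastArgmax-new : ∀ {D n N z} → LastArgmax D (suc n) N z → D z ℤ.< D n → LastArgmax D n N n
lastArgmax-new {D} {n} {N} (lastArgmax l b s w) h = lastArgmax ≤-refl (≤-trans (<⇒≤ l) b) s′ w′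
  where
  s′ : ∀ {c} → n < c → c ≤ N → D c ℤ.< D n
  s′ n<c c≤N = ℤₚ.≤-<-trans (w n<c c≤N) h
  w′ : ∀ {c} → n ≤ c → c ≤ N → D c ℤ.≤ D n
  w′ n≤ c≤N with m≤n⇒m<n∨m≡n n≤
  ... | inj₁ n<c  = ℤₚ.<⇒≤ (s′ n<c c≤N)
  ... | inj₂ refl = ℤₚ.≤-refl

-- Without an unmatched - the empty prefix is already maximal, hence the default 0. Dually `lastPos`
-- defaults to the full prefix N, and an unmatched + at y puts the maximum at y - 1.
firstPos : Maybe ℕ → ℕ
firstPos nothing  = 0
firstPos (just x) = x

lastPos : ℕ → Maybe ℕ → ℕ
lastPos N nothing  = N
lastPos N (just y) = y ∸ 1

lastMinus-argmax : ∀ {D N u} → LastMinus D N u → FirstArgmax D N (firstPos u)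
lastMinus-argmax (none a) = a
lastMinus-argmax (some a) = a

firstPlus-argmax : ∀ {D M N u} → FirstPlus D M N u → LastArgmax D M N (lastPos N u)
firstPlus-argmax (none a)   = a
firstPlus-argmax (some _ a) = a

lastMinus-extend : ∀ {D n u} → LastMinus D n u → D (suc n) ℤ.≤ D (firstPos u) → LastMinus D (suc n) u
lastMinus-extend (none a) h = none (firstArgmax-extend a h)
lastMinus-extend (some a) h = some (firstArgmax-extend a h)

firstPlus-extend : ∀ {D n N u} → FirstPlus D (suc n) N u → D n ℤ.≤ D (lastPos N u) → FirstPlus D n N u
firstPlus-extend (none a)   h = none (lastArgmax-extend a h)
firstPlus-extend (some l a) h = some l (lastArgmax-extend a h)

-- Bracketing scans find extremal maxima

+suc : ∀ o i → + suc o ℤ.+ i ≡ + o ℤ.+ ℤ.suc i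
+suc o i = trans (cong (λ t → + t ℤ.+ i) (+-comm 1 o)) (ℤₚ.+-assoc (+ o) (+ 1) i)

excess⇒≤ : ∀ {i j o} → j ≡ + o ℤ.+ i → i ℤ.≤ j
excess⇒≤ {i} {o = o} refl = ℤₚ.i≤j+i i (+ o)

-- Common form of both scans: the first Boolean marks the sign that closes a bracket or is recorded,
-- the second the sign that opens one. A column with both letters is neutral.
scanStep : Bool → Bool → ℕ × Maybe ℕ → ℕ → ℕ × Maybe ℕ
scanStep true  false (zero  , u) j = zero , just j
scanStep true  false (suc o , u) j = o , u
scanStep false true  (o     , u) j = suc o , u
scanStep true  true  s           j = s
scanStep false false s           j = s

module _ (p q : ℕ → Bool) (N : ℕ) where

  private
    D : ℕ → ℤ
    D = height p q

    still : ∀ {n} → p (suc n) ≡ q (suc n) → D (suc n) ≡ D n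
    still {n} = height-flat p q n

  -- The open signs measure how far the height has dropped below its maximum.
  FInv : ℕ → ℕ × Maybe ℕ → Set
  FInv n (o , u) = LastMinus D n u × D (firstPos u) ≡ + o ℤ.+ D n

  EInv : ℕ → ℕ × Maybe ℕ → Set
  EInv n (o , u) = FirstPlus D n N u × D (lastPos N u) ≡ + o ℤ.+ D n

  -- Only a - met with no open + lifts the height above its previous maximum; any other column
  -- merely changes the deficit o.
  FInv-step : ∀ x y n s → p (suc n) ≡ x → q (suc n) ≡ y →
              FInv n s → FInv (suc n) (scanStep x y s (suc n))
  FInv-step true true n (o , u) ep eq (lm , e) = lastMinus-extend lm (excess⇒≤ {o = o} e′) , e′
    where
    e′ : D (firstPos u) ≡ + o ℤ.+ D (suc n)
    e′ = trans e (cong (ℤ._+_ (+ o)) (sym (still (trans ep (sym eq)))))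
  FInv-step false false n (o , u) ep eq (lm , e) = lastMinus-extend lm (excess⇒≤ {o = o} e′) , e′
    where
    e′ : D (firstPos u) ≡ + o ℤ.+ D (suc n)
    e′ = trans e (cong (ℤ._+_ (+ o)) (sym (still (trans ep (sym eq)))))
  FInv-step false true n (o , u) ep eq (lm , e) = lastMinus-extend lm (excess⇒≤ {o = suc o} e′) , e′
    where
    e′ : D (firstPos u) ≡ + suc o ℤ.+ D (suc n)
    e′ = trans e (trans (cong (ℤ._+_ (+ o)) (height-down p q n ep eq)) (sym (+suc o (D (suc n)))))
  FInv-step true false n (zero , u) ep eq (lm , e) =
    some (firstArgmax-new (lastMinus-argmax lm) lt) , sym (ℤₚ.+-identityˡ (D (suc n)))
    where
    lt : D (firstPos u) ℤ.< D (suc n)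
    lt = subst₂ ℤ._<_ (sym (trans e (ℤₚ.+-identityˡ (D n)))) (sym (height-up p q n ep eq)) (i<suc[i] (D n))
  FInv-step true false n (suc o , u) ep eq (lm , e) = lastMinus-extend lm (excess⇒≤ {o = o} e′) , e′
    where
    e′ : D (firstPos u) ≡ + o ℤ.+ D (suc n)
    e′ = trans e (trans (+suc o (D n)) (cong (ℤ._+_ (+ o)) (sym (height-up p q n ep eq))))

  -- Read backwards, a + raises the height and a - lowers it, so the two signs trade places in
  -- `scanStep`.
  EInv-step : ∀ x y n s → p (suc n) ≡ x → q (suc n) ≡ y → n < N →
              EInv (suc n) s → EInv n (scanStep y x s (suc n))
  EInv-step true true n (o , u) ep eq _ (fp , e) = firstPlus-extend fp (excess⇒≤ {o = o} e′) , e′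
    where
    e′ : D (lastPos N u) ≡ + o ℤ.+ D n
    e′ = trans e (cong (ℤ._+_ (+ o)) (still (trans ep (sym eq))))
  EInv-step false false n (o , u) ep eq _ (fp , e) = firstPlus-extend fp (excess⇒≤ {o = o} e′) , e′
    where
    e′ : D (lastPos N u) ≡ + o ℤ.+ D n
    e′ = trans e (cong (ℤ._+_ (+ o)) (still (trans ep (sym eq))))
  EInv-step true false n (o , u) ep eq _ (fp , e) = firstPlus-extend fp (excess⇒≤ {o = suc o} e′) , e′
    where
    e′ : D (lastPos N u) ≡ + suc o ℤ.+ D n
    e′ = trans e (trans (cong (ℤ._+_ (+ o)) (height-up p q n ep eq)) (sym (+suc o (D n))))
  EInv-step false true n (zero , u) ep eq n<N (fp , e) =
    some n<N (lastArgmax-new (firstPlus-argmax fp) lt) , sym (ℤₚ.+-identityˡ (D n))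
    where
    lt : D (lastPos N u) ℤ.< D n
    lt = subst₂ ℤ._<_ (sym (trans e (ℤₚ.+-identityˡ (D (suc n))))) (sym (height-down p q n ep eq)) (i<suc[i] (D (suc n)))
  EInv-step false true n (suc o , u) ep eq _ (fp , e) = firstPlus-extend fp (excess⇒≤ {o = o} e′) , e′
    where
    e′ : D (lastPos N u) ≡ + o ℤ.+ D n
    e′ = trans e (trans (+suc o (D (suc n))) (cong (ℤ._+_ (+ o)) (sym (height-down p q n ep eq))))

  module _ (step : ℕ × Maybe ℕ → ℕ → ℕ × Maybe ℕ) where

    FInv-fold : (∀ s j → step s j ≡ scanStep (p j) (q j) s j) →
                ∀ n → FInv n (foldl step (0 , nothing) (applyUpTo suc n))
    FInv-fold h zero = none (firstArgmax z≤n (λ ()) (λ { z≤n → ℤₚ.≤-refl })) , refl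
    FInv-fold h (suc n) = subst (FInv (suc n)) (sym last-step)
      (FInv-step _ _ n s refl refl (FInv-fold h n))
      where
      s : ℕ × Maybe ℕ
      s = foldl step (0 , nothing) (applyUpTo suc n)
      -- `foldl` consumes the front of the list, so induction on the prefix has to split off the
      -- last column.
      last-step : foldl step (0 , nothing) (applyUpTo suc (suc n)) ≡
                  scanStep (p (suc n)) (q (suc n)) s (suc n)
      last-step = trans (cong (foldl step (0 , nothing)) (sym (applyUpTo-∷ʳ suc n)))
                 (trans (foldl-∷ʳ step (0 , nothing) (suc n) (applyUpTo suc n)) (h s (suc n)))

    EInv-fold : (∀ s j → step s j ≡ scanStep (q j) (p j) s j) →
                ∀ n s → n ≤ N → EInv n s → EInv 0 (foldl step s (applyDownFrom suc n))
    EInv-fold h zero    s _   inv = inv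
    EInv-fold h (suc n) s n<N inv = EInv-fold h n _ (<⇒≤ n<N)
      (subst (EInv n) (sym (h s (suc n))) (EInv-step _ _ n s refl refl n<N inv))

  EInv-top : EInv N (0 , nothing)
  EInv-top = none (lastArgmax ≤-refl ≤-refl (λ N<c c≤N → contradiction c≤N (<⇒≱ N<c))
      (λ N≤c c≤N → ℤₚ.≤-reflexive (cong D (≤-antisym c≤N N≤c)))) , sym (ℤₚ.+-identityˡ (D N))

-- The signature of a tableau read by columns

module _ (la mu : List ℕ) (T : Tableau) (k : ℕ) where

  minusCol plusCol : ℕ → Bool
  minusCol j = colHas la mu T j k
  plusCol  j = colHas la mu T j (suc k)

  colHeight : ℕ → ℤ
  colHeight = height minusCol plusCol

  private
    N : ℕ
    N = part la 1

  fScan≡scanStep : ∀ s j → fScan la mu T k s j ≡ scanStep (minusCol j) (plusCol j) s j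
  fScan≡scanStep (o , u) j with minusCol j | plusCol j
  ... | true  | true  = refl
  ... | false | true  = refl
  ... | false | false = refl
  ... | true  | false with o
  ...   | zero  = refl
  ...   | suc _ = refl

  eScan≡scanStep : ∀ s j → eScan la mu T k s j ≡ scanStep (plusCol j) (minusCol j) s j
  eScan≡scanStep (o , u) j with plusCol j | minusCol j
  ... | true  | true  = refl
  ... | false | true  = refl
  ... | false | false = refl
  ... | true  | false with o
  ...   | zero  = refl
  ...   | suc _ = refl

  fScan-lastMinus : LastMinus colHeight N (snd (foldl (fScan la mu T k) (0 , nothing) (columns la)))
  fScan-lastMinus = proj₁ (FInv-fold minusCol plusCol N (fScan la mu T k) fScan≡scanStep N)

  eScan-firstPlus : FirstPlus colHeight 0 N
                      (snd (foldl (eScan la mu T k) (0 , nothing) (reverse (columns la))))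
  eScan-firstPlus =
    subst (λ cs → FirstPlus colHeight 0 N (snd (foldl (eScan la mu T k) (0 , nothing) cs)))
      (sym (reverse-applyUpTo suc N))
      (proj₁ (EInv-fold minusCol plusCol N (eScan la mu T k) eScan≡scanStep N (0 , nothing) ≤-refl
               (EInv-top minusCol plusCol N)))

T⇒≡ : ∀ {b} → T b → b ≡ true
T⇒≡ = Equivalence.to T-≡

≡⇒T : ∀ {b} → b ≡ true → T b
≡⇒T = Equivalence.from T-≡

≢true⇒false : ∀ {b} → b ≢ true → b ≡ false
≢true⇒false {false} _ = refl
≢true⇒false {true}  h = contradiction refl h

true⇔⇒≡ : ∀ {b c} → (b ≡ true → c ≡ true) → (c ≡ true → b ≡ true) → b ≡ c
true⇔⇒≡ {true}  {c}     f g = sym (f refl)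
true⇔⇒≡ {false} {true}  f g = g refl
true⇔⇒≡ {false} {false} f g = refl

any-true⁺ : ∀ {A : Set} (f : A → Bool) {x xs} → x ∈ xs → f x ≡ true → any f xs ≡ true
any-true⁺ f (here refl) e rewrite e = refl
any-true⁺ f {xs = y ∷ ys} (there x∈) e rewrite any-true⁺ f x∈ e = ∨-zeroʳ (f y)

any-true⁻ : ∀ {A : Set} (f : A → Bool) xs → any f xs ≡ true → ∃ λ x → x ∈ xs × f x ≡ true
any-true⁻ f (x ∷ xs) h with f x in e
... | true  = x , here refl , e
... | false with y , y∈ , fy ← any-true⁻ f xs h = y , there y∈ , fy

∈⇒∈ᵇ : ∀ {x xs} → x ∈ xs → (x ∈ᵇ xs) ≡ true
∈⇒∈ᵇ {x} x∈ = any-true⁺ (_≡ᵇ x) x∈ (T⇒≡ (≡⇒≡ᵇ x x refl))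

∈ᵇ⇒∈ : ∀ {x xs} → (x ∈ᵇ xs) ≡ true → x ∈ xs
∈ᵇ⇒∈ {x} {xs} h with y , y∈ , e ← any-true⁻ (_≡ᵇ x) xs h
  rewrite ≡ᵇ⇒≡ y x (≡⇒T e) = y∈

∉⇒∈ᵇ : ∀ {x xs} → x ∉ xs → (x ∈ᵇ xs) ≡ false
∉⇒∈ᵇ x∉ = ≢true⇒false (x∉ ∘ ∈ᵇ⇒∈)

∈ᵇ-cong : ∀ {x xs ys} → (x ∈ xs → x ∈ ys) → (x ∈ ys → x ∈ xs) → (x ∈ᵇ xs) ≡ (x ∈ᵇ ys)
∈ᵇ-cong f g = true⇔⇒≡ (∈⇒∈ᵇ ∘ f ∘ ∈ᵇ⇒∈) (∈⇒∈ᵇ ∘ g ∘ ∈ᵇ⇒∈)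

∈-filterᵇ⁺ : ∀ {A : Set} (f : A → Bool) {x xs} → x ∈ xs → f x ≡ true → x ∈ filterᵇ f xs
∈-filterᵇ⁺ f x∈ e = ∈-filter⁺ _ x∈ (≡⇒T e)

∈-filterᵇ⁻ : ∀ {A : Set} (f : A → Bool) {x xs} → x ∈ filterᵇ f xs → x ∈ xs × f x ≡ true
∈-filterᵇ⁻ f x∈ with x∈xs , t ← ∈-filter⁻ (T? ∘ f) x∈ = x∈xs , T⇒≡ t

≢⇒not-≡ᵇ : ∀ {x y} → x ≢ y → not (x ≡ᵇ y) ≡ true
≢⇒not-≡ᵇ {x} {y} ne with x ≡ᵇ y in e
... | false = refl
... | true  = contradiction (≡ᵇ⇒≡ x y (≡⇒T e)) ne

not-≡ᵇ⇒≢ : ∀ {x y} → not (x ≡ᵇ y) ≡ true → x ≢ y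
not-≡ᵇ⇒≢ {x} {.x} h refl with () ← trans (sym h) (cong not (T⇒≡ (≡⇒≡ᵇ x x refl)))

∈-remove⁺ : ∀ {x y xs} → y ∈ xs → y ≢ x → y ∈ remove x xs
∈-remove⁺ y∈ ne = ∈-filterᵇ⁺ _ y∈ (≢⇒not-≡ᵇ ne)

∈-remove⁻ : ∀ {x y xs} → y ∈ remove x xs → y ∈ xs × y ≢ x
∈-remove⁻ {x} y∈ with y∈xs , e ← ∈-filterᵇ⁻ (λ z → not (z ≡ᵇ x)) y∈ = y∈xs , not-≡ᵇ⇒≢ e

minL-nothing : ∀ xs → minL xs ≡ nothing → xs ≡ []
minL-nothing []       _ = refl
minL-nothing (x ∷ xs) h with minL xs
minL-nothing (x ∷ xs) () | nothing
minL-nothing (x ∷ xs) () | just _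

maxL-nothing : ∀ xs → maxL xs ≡ nothing → xs ≡ []
maxL-nothing []       _ = refl
maxL-nothing (x ∷ xs) h with maxL xs
maxL-nothing (x ∷ xs) () | nothing
maxL-nothing (x ∷ xs) () | just _

minL-just : ∀ xs {m} → minL xs ≡ just m → m ∈ xs × (∀ {y} → y ∈ xs → m ≤ y)
minL-just (x ∷ xs) h with minL xs in e
minL-just (x ∷ xs) refl | nothing rewrite minL-nothing xs e =
  here refl , λ { (here refl) → ≤-refl }
minL-just (x ∷ xs) refl | just y with y∈ , low ← minL-just xs e with ⊓-sel x y
... | inj₁ q rewrite q = here refl , λ { (here refl) → ≤-refl ; (there z∈) → ≤-trans (m⊓n≡m⇒m≤n q) (low z∈) }
... | inj₂ q rewrite q = there y∈ , λ { (here refl) → m⊓n≡n⇒n≤m q ; (there z∈) → low z∈ }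

maxL-just : ∀ xs {m} → maxL xs ≡ just m → m ∈ xs × (∀ {y} → y ∈ xs → y ≤ m)
maxL-just (x ∷ xs) h with maxL xs in e
maxL-just (x ∷ xs) refl | nothing rewrite maxL-nothing xs e =
  here refl , λ { (here refl) → ≤-refl }
maxL-just (x ∷ xs) refl | just y with y∈ , up ← maxL-just xs e with ⊔-sel x y
... | inj₁ q rewrite q = here refl , λ { (here refl) → ≤-refl ; (there z∈) → ≤-trans (up z∈) (m⊔n≡m⇒n≤m q) }
... | inj₂ q rewrite q = there y∈ , λ { (here refl) → m⊔n≡n⇒m≤n q ; (there z∈) → up z∈ }

-- Greedy pairing finds extremal maxima

-- Wherever D′ may exceed D, its value recurs on both sides, so such a point is neither the first
-- nor the last maximum of D′. At an extremal maximum of D′ the functions therefore agree, and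
-- elsewhere D is no larger; this carries the maximum over to D.
Raised : (D D′ : ℕ → ℤ) (N c : ℕ) → Set
Raised D D′ N c = D c ≡ D′ c ⊎
  (D c ℤ.≤ D′ c × (∃ λ l → l < c × D′ l ≡ D′ c) × (∃ λ r → c < r × r ≤ N × D′ r ≡ D′ c))

raised⇒≤ : ∀ {D D′ N c} → Raised D D′ N c → D c ℤ.≤ D′ c
raised⇒≤ (inj₁ e)       = ℤₚ.≤-reflexive e
raised⇒≤ (inj₂ (h , _)) = h

firstArgmax-lower : ∀ {D D′ N x} → (∀ c → Raised D D′ N c) → FirstArgmax D′ N x → FirstArgmax D N x
firstArgmax-lower {D} {D′} {N} {x} R (firstArgmax b s w) with R x
... | inj₂ (_ , (l , l<x , e) , _) = contradiction (s l<x) (ℤₚ.<-irrefl e)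
... | inj₁ e = firstArgmax b
      (λ {c} c<x → ℤₚ.≤-<-trans (raised⇒≤ {D} {D′} {N} (R c)) (ℤₚ.<-≤-trans (s c<x) (ℤₚ.≤-reflexive (sym e))))
      (λ {c} c≤N → ℤₚ.≤-trans (raised⇒≤ {D} {D′} {N} (R c)) (ℤₚ.≤-trans (w c≤N) (ℤₚ.≤-reflexive (sym e))))

lastArgmax-lower : ∀ {D D′ M N z} → (∀ c → Raised D D′ N c) → LastArgmax D′ M N z → LastArgmax D M N z
lastArgmax-lower {D} {D′} {N = N} {z} R (lastArgmax l b s w) with R z
... | inj₂ (_ , _ , r , z<r , r≤N , e) = contradiction (s z<r r≤N) (ℤₚ.<-irrefl e)
... | inj₁ e = lastArgmax l b
      (λ {c} z<c c≤N → ℤₚ.≤-<-trans (raised⇒≤ {D} {D′} {N} (R c)) (ℤₚ.<-≤-trans (s z<c c≤N) (ℤₚ.≤-reflexive (sym e))))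
      (λ {c} M≤c c≤N → ℤₚ.≤-trans (raised⇒≤ {D} {D′} {N} (R c)) (ℤₚ.≤-trans (w M≤c c≤N) (ℤₚ.≤-reflexive (sym e))))

lastMinus-lower : ∀ {D D′ N u} → (∀ c → Raised D D′ N c) → LastMinus D′ N u → LastMinus D N u
lastMinus-lower R (none a) = none (firstArgmax-lower R a)
lastMinus-lower R (some a) = some (firstArgmax-lower R a)

firstPlus-lower : ∀ {D D′ M N u} → (∀ c → Raised D D′ N c) → FirstPlus D′ M N u → FirstPlus D M N u
firstPlus-lower R (none a)   = none (lastArgmax-lower R a)
firstPlus-lower R (some l a) = some l (lastArgmax-lower R a)

letterHeight : List ℕ → List ℕ → ℕ → ℤ
letterHeight hk hk1 = height (_∈ᵇ hk) (_∈ᵇ hk1)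

Within : ℕ → List ℕ → Set
Within N xs = ∀ {x} → x ∈ xs → 1 ≤ x × x ≤ N

-- Deleting a + at b together with the first − weakly after it, when no other +
-- lies between, only raises the height, and only strictly inside a plateau.
raise-pair : ∀ {N a b av bs} → 1 ≤ b → b ≤ a → a ≤ N → a ∈ av → b ∉ bs →
             (∀ {y} → y ∈ av → b ≤ y → a ≤ y) → (∀ {y} → y ∈ bs → b ≤ y → a < y) →
             ∀ c → Raised (letterHeight av (b ∷ bs)) (letterHeight (remove a av) bs) N c
raise-pair {N} {a} {suc b} {av} {bs} 1≤b b≤a a≤N a∈ b∉ av-gap bs-gap c = result
  where
  p p′ q q′ : ℕ → Bool
  p  = _∈ᵇ av
  p′ = _∈ᵇ remove a av
  q  = _∈ᵇ (suc b ∷ bs)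
  q′ = _∈ᵇ bs

  p≡p′ : ∀ i → i ≢ a → p i ≡ p′ i
  p≡p′ i ne = ∈ᵇ-cong {i} {av} {remove a av} (λ i∈ → ∈-remove⁺ i∈ ne) (proj₁ ∘ ∈-remove⁻ {a})

  q≡q′ : ∀ i → i ≢ suc b → q i ≡ q′ i
  q≡q′ i ne = ∈ᵇ-cong {xs = suc b ∷ bs} (λ { (here e) → contradiction e ne ; (there i∈) → i∈ }) there

  a∉ : a ∉ remove a av
  a∉ a∈′ = proj₂ (∈-remove⁻ {a} {a} {av} a∈′) refl

  -- Here b is the position just before the +, which sits at `suc b`; after the deletion no letter
  -- remains in (b, a].
  plateau : ∀ {d} → b ≤ d → d ≤ a → height p′ q′ d ≡ height p′ q′ b
  plateau {d} b≤d d≤a = height-cong {p′} {q′} {p′} {q′} {d} {b}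
    (count-const p′ b≤d (λ i b<i i≤d → ∉⇒∈ᵇ (λ i∈ →
      let i∈av , i≢a = ∈-remove⁻ i∈ in
      i≢a (≤-antisym (≤-trans i≤d d≤a) (av-gap i∈av b<i)))))
    (count-const q′ b≤d (λ i b<i i≤d → ∉⇒∈ᵇ (λ i∈ →
      <⇒≱ (bs-gap i∈ b<i) (≤-trans i≤d d≤a))))

  below-p : c < a → count p c ≡ count p′ c
  below-p c<a = count-cong p p′ c (λ i i≤c → p≡p′ i (<⇒≢ (≤-<-trans i≤c c<a)))

  above-q : suc b ≤ c → count q c ≡ suc (count q′ c)
  above-q b≤c = count-remove q q′ 1≤b b≤c (∈⇒∈ᵇ {xs = suc b ∷ bs} (here refl)) (∉⇒∈ᵇ b∉) q≡q′

  result : Raised (height p q) (height p′ q′) N c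
  result with suc b ≤? c | a ≤? c
  ... | no b≰c | _ = inj₁ (height-cong {p} {q} {p′} {q′} {c} {c} (below-p (<-≤-trans (≰⇒> b≰c) b≤a))
        (count-cong q q′ c (λ i i≤c → q≡q′ i (<⇒≢ (≤-<-trans i≤c (≰⇒> b≰c))))))
  ... | yes b≤c | yes a≤c = inj₁ (trans
        (cong₂ _⊖_ (count-remove p p′ (≤-trans 1≤b b≤a) a≤c (∈⇒∈ᵇ a∈) (∉⇒∈ᵇ a∉) p≡p′) (above-q b≤c))
        (ℤₚ.[1+m]⊖[1+n]≡m⊖n (count p′ c) (count q′ c)))
  -- Between the deleted letters the + is gone but the - was not yet counted. The ends b and a of
  -- the plateau supply the two recurrences.
  ... | yes b≤c | no a≰c = inj₂
        ( height-mono {p} {q} {p′} {q′} {c} {c} (≤-reflexive (below-p (≰⇒> a≰c)))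
            (≤-trans (n≤1+n _) (≤-reflexive (sym (above-q b≤c))))
        , (b , b≤c , sym (plateau (<⇒≤ b≤c) (<⇒≤ (≰⇒> a≰c))))
        , (a , ≰⇒> a≰c , a≤N , trans (plateau (<⇒≤ b≤a) ≤-refl) (sym (plateau (<⇒≤ b≤c) (<⇒≤ (≰⇒> a≰c))))))

count-none : ∀ p n → (∀ i → i ≤ n → p i ≡ false) → count p n ≡ 0
count-none p n h = count-const p z≤n (λ i _ → h i)

-- The word left after pairing is -⋯-+⋯+: its height climbs up to the last - and falls from the
-- first + on, so the extremal maxima are visible directly.
lastMinus-separated : ∀ {N av V} → Within N av → (∀ {a v} → a ∈ av → v ∈ V → a < v) →
                      LastMinus (letterHeight av V) N (maxL av)
lastMinus-separated {N} {av} {V} wa sep with maxL av in e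
... | nothing rewrite maxL-nothing av e = none (firstArgmax z≤n (λ ()) (λ {c} _ →
        height-mono {_∈ᵇ []} {_∈ᵇ V} {_∈ᵇ []} {_∈ᵇ V} {c} {0}
          (≤-reflexive (count-none _ c (λ _ _ → refl))) z≤n))
... | just zero with () ← proj₁ (wa (proj₁ (maxL-just av e)))
... | just (suc x′) = some (firstArgmax (proj₂ (wa x∈)) strict weak)
  where
  x∈ : suc x′ ∈ av
  x∈ = proj₁ (maxL-just av e)
  p q : ℕ → Bool
  p = _∈ᵇ av
  q = _∈ᵇ V
  q-none : ∀ {c} → c ≤ suc x′ → count q c ≡ 0
  q-none {c} c≤ = count-none q c (λ i i≤c → ∉⇒∈ᵇ (λ i∈ → <⇒≱ (sep x∈ i∈) (≤-trans i≤c c≤)))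
  strict : ∀ {c} → c < suc x′ → height p q c ℤ.< height p q (suc x′)
  strict {c} c<@(s≤s c≤x′) rewrite q-none (<⇒≤ c<) | q-none {suc x′} ≤-refl =
    ℤₚ.⊖-monoˡ-< 0 (subst (count p c <_) (sym (count-true p x′ (∈⇒∈ᵇ x∈))) (s≤s (count-mono p c≤x′)))
  weak : ∀ {c} → c ≤ N → height p q c ℤ.≤ height p q (suc x′)
  weak {c} _ with c <? suc x′
  ... | yes c<x = ℤₚ.<⇒≤ (strict c<x)
  ... | no  c≮x = height-mono {p} {q} {p} {q} {c} {suc x′}
        (≤-reflexive (count-const p (≮⇒≥ c≮x) (λ i x<i _ → ∉⇒∈ᵇ (λ i∈ → <⇒≱ x<i (proj₂ (maxL-just av e) i∈)))))
        (count-mono q (≮⇒≥ c≮x))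

firstPlus-separated : ∀ {N av V} → Within N V → (∀ {a v} → a ∈ av → v ∈ V → a < v) →
                      FirstPlus (letterHeight av V) 0 N (minL V)
firstPlus-separated {N} {av} {V} wv sep with minL V in e
... | nothing rewrite minL-nothing V e = none (lastArgmax z≤n ≤-refl
        (λ N<c c≤N → contradiction c≤N (<⇒≱ N<c))
        (λ {c} _ c≤N → height-mono {_∈ᵇ av} {_∈ᵇ []} {_∈ᵇ av} {_∈ᵇ []} {c} {N}
          (count-mono _ c≤N) (≤-reflexive (trans (count-none _ N (λ _ _ → refl)) (sym (count-none _ c (λ _ _ → refl)))))))
... | just zero with () ← proj₁ (wv (proj₁ (minL-just V e)))
... | just (suc z) = some (proj₂ (wv y∈)) (lastArgmax z≤n (<⇒≤ (proj₂ (wv y∈))) strict weak)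
  where
  y∈ : suc z ∈ V
  y∈ = proj₁ (minL-just V e)
  p q : ℕ → Bool
  p = _∈ᵇ av
  q = _∈ᵇ V
  q-none : ∀ {c} → c ≤ z → count q c ≡ 0
  q-none {c} c≤ = count-none q c (λ i i≤c → ∉⇒∈ᵇ (λ i∈ → <⇒≱ (s≤s (≤-trans i≤c c≤)) (proj₂ (minL-just V e) i∈)))
  strict : ∀ {c} → z < c → c ≤ N → height p q c ℤ.< height p q z
  strict {c} z<c _
    rewrite count-const p {z} {c} (<⇒≤ z<c) (λ i z<i _ → ∉⇒∈ᵇ (λ i∈ → <⇒≱ (sep i∈ y∈) z<i)) =
    ℤₚ.⊖-monoʳ->-< (count p z) (<-≤-trans (≤-reflexive (sym (count-true q z (∈⇒∈ᵇ y∈)))) (count-mono q z<c))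
  weak : ∀ {c} → 0 ≤ c → c ≤ N → height p q c ℤ.≤ height p q z
  weak {c} _ c≤N with z <? c
  ... | yes z<c = ℤₚ.<⇒≤ (strict z<c c≤N)
  ... | no  z≮c = height-mono {p} {q} {p} {q} {c} {z} (count-mono p (≮⇒≥ z≮c))
        (≤-reflexive (trans (q-none ≤-refl) (sym (q-none (≮⇒≥ z≮c)))))

-- A state of the pairing: free -'s `av`, +'s already found unpaired `V`, +'s still to be read `bs`.
-- Reading in decreasing order keeps `bs` below `V`, and a + stays unpaired only if every free -
-- lies below it, whence `av<V`.
record Pairable (N : ℕ) (av V bs : List ℕ) : Set where
  constructor pairable
  field
    av-within : Within N av
    V-within  : Within N V
    bs-within : Within N bs
    bs-desc   : AllPairs _>_ bs
    bs<V      : ∀ {b v} → b ∈ bs → v ∈ V → b < v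
    av<V      : ∀ {a v} → a ∈ av → v ∈ V → a < v

Unmatched : ℕ → (ℕ → ℤ) → List ℕ × List ℕ → Set
Unmatched N D (av , V) = LastMinus D N (maxL av) × FirstPlus D 0 N (minL V)

-- The height is taken of the word still present. A paired + removes two letters and raises the
-- height harmlessly; an unpaired + only moves from `bs` to `V`, leaving the word as it is; the
-- final word is separated.
pairing-fold : ∀ {N} bs {av V} → Pairable N av V bs →
               Unmatched N (letterHeight av (bs ++ V)) (foldl pairStep (av , V) bs)
pairing-fold [] (pairable wa wv _ _ _ sep) = lastMinus-separated wa sep , firstPlus-separated wv sep
pairing-fold {N} (b ∷ bs) {av} {V} (pairable wa wv wb (b> ∷ desc) b<V sep)
  with minL (filterᵇ (b ≤ᵇ_) av) in e
... | just a = lastMinus-lower raise (proj₁ rest) , firstPlus-lower raise (proj₂ rest)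
  where
  spec = minL-just (filterᵇ (b ≤ᵇ_) av) e
  a∈ : a ∈ av
  a∈ = proj₁ (∈-filterᵇ⁻ (b ≤ᵇ_) (proj₁ spec))
  b≤a : b ≤ a
  b≤a = ≤ᵇ⇒≤ b a (≡⇒T (proj₂ (∈-filterᵇ⁻ (b ≤ᵇ_) {xs = av} (proj₁ spec))))
  b∉ : b ∉ bs ++ V
  b∉ b∈ = [ (λ b∈bs → <-irrefl refl (All.lookup b> b∈bs))
          , (λ b∈V → <-irrefl refl (b<V (here refl) b∈V)) ]′ (∈-++⁻ bs b∈)
  -- No + interferes between b and a: unread ones lie below b, unpaired ones above every free -.
  gap : ∀ {y} → y ∈ bs ++ V → b ≤ y → a < y
  gap y∈ b≤y = [ (λ y∈bs → contradiction b≤y (<⇒≱ (All.lookup b> y∈bs)))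
               , (λ y∈V → sep a∈ y∈V) ]′ (∈-++⁻ bs y∈)
  raise = raise-pair {N} {a} {b} {av} {bs ++ V} (proj₁ (wb (here refl))) b≤a (proj₂ (wa a∈)) a∈ b∉
            (λ y∈ b≤y → proj₂ spec (∈-filterᵇ⁺ (b ≤ᵇ_) y∈ (T⇒≡ (≤⇒≤ᵇ b≤y)))) gap
  rest = pairing-fold bs (pairable (wa ∘ proj₁ ∘ ∈-remove⁻) wv (wb ∘ there) desc (b<V ∘ there)
           (sep ∘ proj₁ ∘ ∈-remove⁻))
... | nothing = lastMinus-lower same (proj₁ rest) , firstPlus-lower same (proj₂ rest)
  where
  av<b : ∀ {a} → a ∈ av → a < b
  av<b {a} a∈ = ≰⇒> λ b≤a →
    case subst (a ∈_) (minL-nothing _ e) (∈-filterᵇ⁺ (b ≤ᵇ_) a∈ (T⇒≡ (≤⇒≤ᵇ b≤a))) of λ ()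
  move : ∀ {y} → y ∈ b ∷ bs ++ V → y ∈ bs ++ b ∷ V
  move (here refl) = ∈-++⁺ʳ bs (here refl)
  move (there y∈) = [ ∈-++⁺ˡ , ∈-++⁺ʳ bs ∘ there ]′ (∈-++⁻ bs y∈)
  back : ∀ {y} → y ∈ bs ++ b ∷ V → y ∈ b ∷ bs ++ V
  back y∈ with ∈-++⁻ bs y∈
  ... | inj₁ y∈bs         = there (∈-++⁺ˡ y∈bs)
  ... | inj₂ (here refl)  = here refl
  ... | inj₂ (there y∈V)  = there (∈-++⁺ʳ bs y∈V)
  same : ∀ c → Raised (letterHeight av (b ∷ bs ++ V)) (letterHeight av (bs ++ b ∷ V)) N c
  same c = inj₁ (cong (count (_∈ᵇ av) c ⊖_)
    (count-cong (_∈ᵇ (b ∷ bs ++ V)) (_∈ᵇ (bs ++ b ∷ V)) c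
      (λ i _ → ∈ᵇ-cong {i} {b ∷ bs ++ V} {bs ++ b ∷ V} move back)))
  rest = pairing-fold bs {av} {b ∷ V} (pairable wa
    (λ { (here refl) → wb (here refl) ; (there v∈) → wv v∈ }) (wb ∘ there) desc
    (λ { y∈ (here refl) → All.lookup b> y∈ ; y∈ (there v∈) → b<V (there y∈) v∈ })
    (λ { a∈ (here refl) → av<b a∈ ; a∈ (there v∈) → sep a∈ v∈ }))

pairing-unmatched : ∀ {N hk hk1} → Within N hk → Within N hk1 → AllPairs _>_ hk1 →
                    Unmatched N (letterHeight hk hk1) (pairing hk hk1)
pairing-unmatched {N} {hk} {hk1} wk wk1 desc =
  subst (λ h → Unmatched N (letterHeight hk h) (pairing hk hk1)) (++-identityʳ hk1)
    (pairing-fold hk1 (pairable wk (λ ()) wk1 desc (λ _ ()) (λ _ ())))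

-- Parts, ranges, and comparison of heights on different scales

∧-true⁻ : ∀ {a b} → a ∧ b ≡ true → a ≡ true × b ≡ true
∧-true⁻ {true} {true} _ = refl , refl

∧-true⁺ : ∀ {a b} → a ≡ true → b ≡ true → a ∧ b ≡ true
∧-true⁺ refl refl = refl

nth-antitone : ∀ {xs} → Linked _≥_ xs → ∀ {i j} → i ≤ j → nth 0 xs j ≤ nth 0 xs i
nth-antitone {[]}     _  _ = z≤n
nth-antitone {x ∷ xs} _ {zero} {zero} _ = ≤-refl
nth-antitone {x ∷ []} _ {zero} {suc j} _ = z≤n
nth-antitone {x ∷ []} _ {suc i} {suc j} _ = z≤n
nth-antitone {x ∷ y ∷ ys} (x≥y ∷ l) {zero} {suc j} _ = ≤-trans (nth-antitone l {0} {j} z≤n) x≥y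
nth-antitone {x ∷ y ∷ ys} (x≥y ∷ l) {suc i} {suc j} (s≤s i≤j) = nth-antitone l i≤j

part-antitone : ∀ {la} → IsPartition la → ∀ {i j} → i ≤ j → part la j ≤ part la i
part-antitone (_ , l) i≤j = nth-antitone l (∸-monoˡ-≤ 1 i≤j)

range⁺ : ∀ {a b x} → a ≤ x → x ≤ b → x ∈ range a b
range⁺ {a} {b} {x} a≤x x≤b = subst (_∈ range a b) (m+[n∸m]≡n a≤x)
  (∈-applyUpTo⁺ (λ t → a + t) (∸-monoˡ-< (s≤s x≤b) a≤x))

m<n∸o⇒m+o<n : ∀ m n o → m < n ∸ o → m + o < n
m<n∸o⇒m+o<n m n       zero    h = subst (_< n) (sym (+-identityʳ m)) h
m<n∸o⇒m+o<n m (suc n) (suc o) h = subst (_< suc n) (sym (+-suc m o)) (s≤s (m<n∸o⇒m+o<n m n o h))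

range⁻ : ∀ {a b x} → x ∈ range a b → a ≤ x × x ≤ b
range⁻ {a} {b} x∈ with t , t< , refl ← ∈-applyUpTo⁻ (λ t → a + t) x∈ =
  m≤m+n a t , s≤s⁻¹ (subst (_< suc b) (+-comm t a) (m<n∸o⇒m+o<n t (suc b) a t<))

-- An order-preserving matching is injective. A relation is used because a partner comes with a
-- witnessing cell.
count-inject : ∀ {P Q : ℕ → Bool} (R : ℕ → ℕ → Set) →
  (∀ {c} → Q c ≡ true → ∃ λ j → R j c) → (∀ {j c} → R j c → 1 ≤ j × P j ≡ true) →
  (∀ {j c j′ c′} → R j c → R j′ c′ → c < c′ → j < j′) →
  ∀ c j → (∀ {j′ c′} → R j′ c′ → c′ ≤ c → j′ ≤ j) → count Q c ≤ count P j
count-inject R toR fromR mono zero j h = z≤n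
count-inject {P} {Q} R toR fromR mono (suc c) j h with Q (suc c) in e
... | false = count-inject {P} {Q} R toR fromR mono c j (λ r c≤ → h r (m≤n⇒m≤1+n c≤))
... | true with toR e
...   | zero , r with () ← proj₁ (fromR r)
-- Once the topmost letter is matched with `suc j′`, monotonicity confines the partners of all
-- smaller ones to at most `j′`.
...   | suc j′ , r = ≤-trans (s≤s (count-inject {P} {Q} R toR fromR mono c j′
                         (λ r′ c≤ → s≤s⁻¹ (mono r′ r (s≤s c≤)))))
                       (≤-trans (≤-reflexive (sym (count-true P j′ (proj₂ (fromR r)))))
                         (count-mono P (h r ≤-refl)))

-- Recovers from a strict first maximum that its column carries a k and no k+1.
height-up⁻ : ∀ p q n → height p q n ℤ.< height p q (suc n) → p (suc n) ≡ true × q (suc n) ≡ false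
height-up⁻ p q n h with p (suc n) in ep | q (suc n) in eq
... | true  | false = refl , refl
... | true  | true  = contradiction h (ℤₚ.<-irrefl (sym (ℤₚ.[1+m]⊖[1+n]≡m⊖n (count p n) (count q n))))
... | false | false = contradiction h (ℤₚ.<-irrefl refl)
... | false | true  = contradiction (ℤₚ.⊖-monoʳ-≥-≤ (count p n) (n≤1+n (count q n))) (ℤₚ.<⇒≱ h)

height-down⁻ : ∀ p q n → height p q (suc n) ℤ.< height p q n → p (suc n) ≡ false × q (suc n) ≡ true
height-down⁻ p q n h with p (suc n) in ep | q (suc n) in eq
... | false | true  = refl , refl
... | true  | true  = contradiction h (ℤₚ.<-irrefl (ℤₚ.[1+m]⊖[1+n]≡m⊖n (count p n) (count q n)))
... | false | false = contradiction h (ℤₚ.<-irrefl refl)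
... | true  | false = contradiction (ℤₚ.⊖-monoˡ-≤ (count q n) (n≤1+n (count p n))) (ℤₚ.<⇒≱ h)

-- Dominating every value of D₂ by some value of D₁ and agreeing at one point is enough; the last
-- clause of the bound preserves strictness.
firstArgmax-transfer : ∀ {D₁ D₂ N₁ N₂ x y} → FirstArgmax D₁ N₁ x → y ≤ N₂ → D₂ y ≡ D₁ x →
  (∀ c → ∃ λ j → j ≤ N₁ × D₂ c ℤ.≤ D₁ j × (c < y → j < x)) → FirstArgmax D₂ N₂ y
firstArgmax-transfer {D₁} {D₂} {N₁} {N₂} {x} {y} (firstArgmax _ s w) y≤N e bd = firstArgmax y≤N
  (λ {c} c<y → let j , _ , le , lt = bd c in
    subst (D₂ c ℤ.<_) (sym e) (ℤₚ.≤-<-trans le (s (lt c<y))))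
  (λ {c} _ → let j , j≤ , le , _ = bd c in subst (D₂ c ℤ.≤_) (sym e) (ℤₚ.≤-trans le (w j≤)))

lastArgmax-transfer : ∀ {D₁ D₂ N₁ N₂ x y} → LastArgmax D₁ 0 N₁ x → y ≤ N₂ → D₂ y ≡ D₁ x →
  (∀ c → c ≤ N₂ → ∃ λ j → j ≤ N₁ × D₂ c ℤ.≤ D₁ j × (y < c → x < j)) → LastArgmax D₂ 0 N₂ y
lastArgmax-transfer {D₁} {D₂} {N₁} {N₂} {x} {y} (lastArgmax _ _ s w) y≤N e bd = lastArgmax z≤n y≤N
  (λ {c} y<c c≤N → let j , j≤ , le , lt = bd c c≤N in
    subst (D₂ c ℤ.<_) (sym e) (ℤₚ.≤-<-trans le (s (lt y<c) j≤)))
  (λ {c} _ c≤N → let j , j≤ , le , _ = bd c c≤N in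
    subst (D₂ c ℤ.≤_) (sym e) (ℤₚ.≤-trans le (w z≤n j≤)))

findᵇ-just : ∀ {A : Set} (f : A → Bool) xs {x} → findᵇ f xs ≡ just x → f x ≡ true
findᵇ-just f (x ∷ xs) e with f x in fx
findᵇ-just f (x ∷ xs) refl | true  = fx
findᵇ-just f (x ∷ xs) e    | false = findᵇ-just f xs e

findᵇ-nothing : ∀ {A : Set} (f : A → Bool) xs → findᵇ f xs ≡ nothing → any f xs ≡ false
findᵇ-nothing f []       _ = refl
findᵇ-nothing f (x ∷ xs) e with f x
findᵇ-nothing f (x ∷ xs) () | true
findᵇ-nothing f (x ∷ xs) e  | false = findᵇ-nothing f xs e

-- Cells, contents and residue words

module Shape (la mu : List ℕ) where

  ℓ N₁ N₂ : ℕ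
  ℓ  = length la
  N₁ = part la 1
  N₂ = ℓ + N₁

  record Cell (i j : ℕ) : Set where
    constructor cell
    field
      1≤row  : 1 ≤ i
      row≤ℓ  : i ≤ ℓ
      mu<col : part mu i < j
      col≤la : j ≤ part la i

  open Cell

  inShape⇒cell : ∀ {i j} → InShape la mu i j → Cell i j
  inShape⇒cell {i} {j} h with a , h₁ ← ∧-true⁻ {1 ≤ᵇ i} h
    with b , h₂ ← ∧-true⁻ {i ≤ᵇ length la} h₁
    with c , d ← ∧-true⁻ {part mu i <ᵇ j} h₂ =
    cell (≤ᵇ⇒≤ 1 i (≡⇒T a)) (≤ᵇ⇒≤ i _ (≡⇒T b)) (<ᵇ⇒< (part mu i) j (≡⇒T c)) (≤ᵇ⇒≤ j _ (≡⇒T d))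

  cell⇒inShape : ∀ {i j} → Cell i j → InShape la mu i j
  cell⇒inShape (cell a b c d) = ∧-true⁺ (T⇒≡ (≤⇒≤ᵇ a)) (∧-true⁺ (T⇒≡ (≤⇒≤ᵇ b))
    (∧-true⁺ (T⇒≡ (<⇒<ᵇ c)) (T⇒≡ (≤⇒≤ᵇ d))))

  -- The additive form avoids truncated subtraction; as a record it lets unification recover i, j
  -- and c.
  record HasContent (i j c : ℕ) : Set where
    constructor hasContent
    field c+i≡ℓ+j : c + i ≡ ℓ + j

  content-hasContent : ∀ {i j} → Cell i j → HasContent i j (content la (i , j))
  content-hasContent {i} {j} s = hasContent (m∸n+n≡m (≤-trans (row≤ℓ s) (m≤m+n ℓ j)))

  hasContent⇒content : ∀ {i j c} → HasContent i j c → content la (i , j) ≡ c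
  hasContent⇒content {i} {j} {c} (hasContent h) = trans (cong (_∸ i) (sym h)) (m+n∸n≡m c i)

  content≤ : ∀ {i j c i′ j′ c′} → HasContent i j c → HasContent i′ j′ c′ →
             i′ ≤ i → j ≤ j′ → c ≤ c′
  content≤ {i} {j} {c} {i′} {j′} {c′} (hasContent h) (hasContent h′) i′≤i j≤j′ =
    +-cancelʳ-≤ i c c′ (begin
      c + i   ≡⟨ h ⟩
      ℓ + j   ≤⟨ +-monoʳ-≤ ℓ j≤j′ ⟩
      ℓ + j′  ≡⟨ sym h′ ⟩
      c′ + i′ ≤⟨ +-monoʳ-≤ c′ i′≤i ⟩
      c′ + i  ∎)
    where open ≤-Reasoning

  hasContent-right : ∀ {i j c} → HasContent i j c → HasContent i (suc j) (suc c)
  hasContent-right {j = j} (hasContent h) = hasContent (trans (cong suc h) (sym (+-suc ℓ j)))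

  hasContent-left : ∀ {i j c} → HasContent i (suc j) (suc c) → HasContent i j c
  hasContent-left {j = j} (hasContent h) = hasContent (suc-injective (trans h (+-suc ℓ j)))

  hasContent-down : ∀ {i j c} → HasContent (suc i) j c → HasContent i j (suc c)
  hasContent-down {i} {c = c} (hasContent h) = hasContent (trans (sym (+-suc c i)) h)

  content< : ∀ {i j c i′ j′ c′} → HasContent i j c → HasContent i′ j′ c′ →
             i′ ≤ i → j < j′ → c < c′
  content< h h′ i′≤i j<j′ = content≤ (hasContent-right h) h′ i′≤i j<j′

  content-unique : ∀ {i j c c′} → HasContent i j c → HasContent i j c′ → c ≡ c′
  content-unique {i} (hasContent h) (hasContent h′) = +-cancelʳ-≡ i _ _ (trans h (sym h′))

  row-unique : ∀ {i i′ j c} → HasContent i j c → HasContent i′ j c → i ≡ i′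
  row-unique {c = c} (hasContent h) (hasContent h′) = +-cancelˡ-≡ c _ _ (trans h (sym h′))

  rowCells : ℕ → List (ℕ × ℕ)
  rowCells i = map (i ,_) (range (suc (part mu i)) (part la i))

  cells⁺ : ∀ {i j} → Cell i j → (i , j) ∈ cells la mu
  cells⁺ {i} {j} (cell 1≤i i≤ mu<j j≤) = ∈-concatMap⁺ rowCells {xs = rows la}
    (lose (range⁺ 1≤i i≤) (∈-map⁺ (i ,_) (range⁺ mu<j j≤)))

  cells⁻ : ∀ {i j} → (i , j) ∈ cells la mu → Cell i j
  cells⁻ {i} ij∈ with i′ , i∈ , ij∈′ ← find (∈-concatMap⁻ rowCells {xs = rows la} ij∈)
    with j′ , j∈ , refl ← ∈-map⁻ (i′ ,_) ij∈′ =
    cell (proj₁ (range⁻ {1} i∈)) (proj₂ (range⁻ {1} i∈))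
         (proj₁ (range⁻ {suc (part mu i)} j∈)) (proj₂ (range⁻ {suc (part mu i)} j∈))

  -- An occurrence of a letter, located by column and by content at once: the two orders to be
  -- compared.
  record At (T : Tableau) (a i j c : ℕ) : Set where
    constructor at
    field
      inside : Cell i j
      entry  : T i j a ≡ true
      diag   : HasContent i j c

  open At public

  at-content : ∀ {T a i j} → Cell i j → T i j a ≡ true → ∃ λ c → At T a i j c
  at-content s t = _ , at s t (content-hasContent s)

  colHas⁺ : ∀ {T a i j c} → At T a i j c → colHas la mu T j a ≡ true
  colHas⁺ {T} {a} {i} {j} (at s t _) = any-true⁺ (λ i → inShapeᵇ la mu i j ∧ T i j a)
    (range⁺ (1≤row s) (row≤ℓ s)) (∧-true⁺ (cell⇒inShape s) t)

  colHas⁻ : ∀ {T a j} → colHas la mu T j a ≡ true → ∃₂ λ i c → At T a i j c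
  colHas⁻ {T} {a} {j} h
    with i , _ , e ← any-true⁻ (λ i → inShapeᵇ la mu i j ∧ T i j a) (rows la) h
    with s , t ← ∧-true⁻ {inShapeᵇ la mu i j} e = i , at-content (inShape⇒cell s) t

  findRow-just : ∀ T a j {i} → findRow la mu T j a ≡ just i → ∃ λ c → At T a i j c
  findRow-just T a j {i} e with s , t ← ∧-true⁻ {inShapeᵇ la mu i j} (findᵇ-just _ (rows la) e) =
    at-content (inShape⇒cell s) t

  findRow-nothing : ∀ T a j → findRow la mu T j a ≡ nothing → colHas la mu T j a ≡ false
  findRow-nothing T a j e = findᵇ-nothing _ (rows la) e

  hword-within : ∀ T a → Within N₂ (hword la mu T a)
  hword-within T a c∈ = range⁻ {1} (reverse⁻ (proj₁ (∈-filterᵇ⁻ _ {xs = reverse (range 1 N₂)} c∈)))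

  hword-desc : ∀ T a → AllPairs _>_ (hword la mu T a)
  hword-desc T a = AllPairsₚ.filter⁺ _
    (subst (AllPairs _>_) (sym (reverse-applyUpTo suc N₂))
      (AllPairsₚ.applyDownFrom⁺₁ suc N₂ (λ j<i _ → s≤s j<i)))

  hword⁻ : ∀ {T a c} → c ∈ hword la mu T a → ∃₂ λ i j → At T a i j c
  hword⁻ {T} {a} {c} c∈ with _ , e ← ∈-filterᵇ⁻ _ {xs = reverse (range 1 N₂)} c∈
    with (i , j) , ij∈ , e′ ← any-true⁻ _ (cells la mu) e
    with e₁ , t ← ∧-true⁻ {content la (i , j) ≡ᵇ c} e′ =
    i , j , at s t (subst (HasContent i j) (≡ᵇ⇒≡ (content la (i , j)) c (≡⇒T e₁)) (content-hasContent s))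
    where
    s : Cell i j
    s = cells⁻ ij∈

  module _ (pla : IsPartition la) where

    1≤column : ∀ {i j} → Cell i j → 1 ≤ j
    1≤column s = ≤-trans (s≤s z≤n) (mu<col s)

    column≤N₁ : ∀ {i j} → Cell i j → j ≤ N₁
    column≤N₁ s = ≤-trans (col≤la s) (part-antitone pla (1≤row s))

    1≤content : ∀ {i j c} → Cell i j → HasContent i j c → 1 ≤ c
    1≤content {i} {j} {suc c} _ _              = s≤s z≤n
    1≤content {i} {j} {zero}  s (hasContent h) = contradiction
      (≤-trans (+-monoʳ-≤ ℓ (1≤column s)) (≤-trans (≤-reflexive (sym h)) (row≤ℓ s)))
      (<⇒≱ (≤-reflexive (sym (+-comm ℓ 1))))

    content≤N₂ : ∀ {i j c} → Cell i j → HasContent i j c → c ≤ N₂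
    content≤N₂ {i} {j} {c} s (hasContent h) =
      ≤-trans (m≤m+n c i) (≤-trans (≤-reflexive h) (+-monoʳ-≤ ℓ (column≤N₁ s)))

    hword⁺ : ∀ {T a i j c} → At T a i j c → c ∈ hword la mu T a
    hword⁺ {c = c} (at s t h) = ∈-filterᵇ⁺ _
      (reverse⁺ (range⁺ (1≤content s h) (content≤N₂ s h)))
      (any-true⁺ _ (cells⁺ s) (∧-true⁺ (T⇒≡ (≡⇒≡ᵇ _ c (hasContent⇒content h))) t))

-- Horizontal strips and the two reading orders

module Strips (la mu : List ℕ) (pla : IsPartition la) (pmu : IsPartition mu)
              (m : ℕ) (T : Tableau) (svt : IsSVT m la mu T) where

  open Shape la mu
  open Cell

  nonempty : ∀ {i j} → Cell i j → ∃ λ a → T i j a ≡ true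
  nonempty s = proj₁ (proj₂ (proj₂ svt)) _ _ (cell⇒inShape s)

  row-step : ∀ {i j a b} → Cell i j → Cell i (suc j) → T i j a ≡ true → T i (suc j) b ≡ true → a ≤ b
  row-step s s′ = proj₁ (proj₂ (proj₂ (proj₂ svt))) _ _ _ _ (cell⇒inShape s) (cell⇒inShape s′)

  col-step : ∀ {i j a b} → Cell i j → Cell (suc i) j → T i j a ≡ true → T (suc i) j b ≡ true → a < b
  col-step s s′ = proj₂ (proj₂ (proj₂ (proj₂ svt))) _ _ _ _ (cell⇒inShape s) (cell⇒inShape s′)

  -- The southwest cell keeps the rectangle outside μ, the northeast cell keeps it inside λ.
  convex : ∀ {i j i′ j′ r s} → Cell i j → Cell i′ j′ → i ≤ r → r ≤ i′ → j ≤ s → s ≤ j′ → Cell r s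
  convex c c′ i≤r r≤i′ j≤s s≤j′ = cell (≤-trans (1≤row c) i≤r) (≤-trans r≤i′ (row≤ℓ c′))
    (≤-<-trans (part-antitone pmu i≤r) (<-≤-trans (mu<col c) j≤s))
    (≤-trans s≤j′ (≤-trans (col≤la c′) (part-antitone pla r≤i′)))

  row-mono : ∀ {i j j′ a b} → suc j ≤′ j′ → Cell i j → Cell i j′ →
             T i j a ≡ true → T i j′ b ≡ true → a ≤ b
  row-mono ≤′-refl s s′ t t′ = row-step s s′ t t′
  row-mono {i} (≤′-step {n} j<n) s s′ t t′ =
    let mid = convex {r = i} {s = n} s s′ ≤-refl ≤-refl (<⇒≤ (≤′⇒≤ j<n)) (n≤1+n n)
        _ , e = nonempty mid
    in ≤-trans (row-mono j<n s mid t e) (row-step mid s′ e t′)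

  -- a + i′ ≤ b + i says that entries grow by at least one per row.
  col-mono : ∀ {i i′ j a b} → suc i ≤′ i′ → Cell i j → Cell i′ j →
             T i j a ≡ true → T i′ j b ≡ true → a + i′ ≤ b + i
  col-mono {i} {a = a} ≤′-refl s s′ t t′ =
    ≤-trans (≤-reflexive (+-suc a i)) (+-monoˡ-≤ i (col-step s s′ t t′))
  col-mono {i} {j = j} {a} (≤′-step {n} i<n) s s′ t t′ =
    let mid = convex {r = n} {s = j} s s′ (<⇒≤ (≤′⇒≤ i<n)) (n≤1+n n) ≤-refl ≤-refl
        _ , e = nonempty mid
    in ≤-trans (≤-reflexive (+-suc a n))
         (≤-trans (s≤s (col-mono i<n s mid t e)) (+-monoˡ-≤ i (col-step mid s′ e t′)))

  -- Go east along the row to the corner below the second cell, then north; convexity puts the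
  -- corner in the shape.
  northeast : ∀ {a b i j c i′ j′ c′} → At T a i j c → At T b i′ j′ c′ →
              i < i′ → j ≤ j′ → a + i′ ≤ b + i
  northeast {a} {b} {i} {j} {i′ = i′} {j′} (at s t _) (at s′ t′ _) i<i′ j≤j′ with m≤n⇒m<n∨m≡n j≤j′
  ... | inj₂ refl = col-mono (≤⇒≤′ i<i′) s s′ t t′
  ... | inj₁ j<j′ =
    let corner = convex {r = i} {s = j′} s s′ ≤-refl (<⇒≤ i<i′) j≤j′ ≤-refl
        _ , e = nonempty corner
    in ≤-trans (+-monoˡ-≤ i′ (row-mono (≤⇒≤′ j<j′) s corner t e)) (col-mono (≤⇒≤′ i<i′) corner s′ e t′)

  -- Going up a row forces a strict increase. With a = b this makes the cells of one letter a
  -- horizontal strip; with k+1 and k it forbids a k northeast of a k+1.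
  not-northeast : ∀ {a b i j c i′ j′ c′} → At T a i j c → At T b i′ j′ c′ →
                  b ≤ a → j ≤ j′ → i′ ≤ i
  not-northeast {a} {b} {i} {i′ = i′} A B b≤a j≤j′ with i <? i′
  ... | no  i≮i′ = ≮⇒≥ i≮i′
  ... | yes i<i′ = contradiction (≤-trans (northeast A B i<i′ j≤j′) (+-monoˡ-≤ i b≤a))
                     (<⇒≱ (+-monoʳ-< a i<i′))

  strip-< : ∀ {a i j c i′ j′ c′} → At T a i j c → At T a i′ j′ c′ → j < j′ → c < c′
  strip-< A B j<j′ = content< (diag A) (diag B) (not-northeast A B ≤-refl (<⇒≤ j<j′)) j<j′

  strip-column : ∀ {a i j c i′ c′} → At T a i j c → At T a i′ j c′ → i ≡ i′ × c ≡ c′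
  strip-column A B with refl ← ≤-antisym (not-northeast B A ≤-refl ≤-refl) (not-northeast A B ≤-refl ≤-refl) =
    refl , content-unique (diag A) (diag B)

  strip-≤ : ∀ {a i j c i′ j′ c′} → At T a i j c → At T a i′ j′ c′ → j ≤ j′ → c ≤ c′
  strip-≤ A B j≤j′ with m≤n⇒m<n∨m≡n j≤j′
  ... | inj₁ j<j′ = <⇒≤ (strip-< A B j<j′)
  ... | inj₂ refl = ≤-reflexive (proj₂ (strip-column A B))

  strip-<⁻ : ∀ {a i j c i′ j′ c′} → At T a i j c → At T a i′ j′ c′ → c < c′ → j < j′
  strip-<⁻ A B c<c′ = ≰⇒> λ j′≤j → <⇒≱ c<c′ (strip-≤ B A j′≤j)

  strip-≤⁻ : ∀ {a i j c i′ j′ c′} → At T a i j c → At T a i′ j′ c′ → c ≤ c′ → j ≤ j′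
  strip-≤⁻ A B c≤c′ = ≮⇒≥ λ j′<j → <⇒≱ (strip-< B A j′<j) c≤c′

  strip-diagonal : ∀ {a i j i′ j′ c} → At T a i j c → At T a i′ j′ c → i ≡ i′ × j ≡ j′
  strip-diagonal A B with refl ← ≤-antisym (strip-≤⁻ A B ≤-refl) (strip-≤⁻ B A ≤-refl) =
    row-unique (diag A) (diag B) , refl

  -- Along a strip rows weakly descend, so the content grows at least as fast as the column; a
  -- content step of one leaves only the right neighbour.
  strip-next : ∀ {a i j i′ j′ c} → At T a i j c → At T a i′ j′ (suc c) → i′ ≡ i × j′ ≡ suc j
  strip-next {i = i} {j} {i′} {j′} {c} A B with ≤-antisym j′≤ (strip-<⁻ A B ≤-refl)
    where
    j′≤ : j′ ≤ suc j
    j′≤ = ≮⇒≥ λ j+1<j′ → <-irrefl refl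
      (content< (hasContent-right (diag A)) (diag B)
        (not-northeast A B ≤-refl (<⇒≤ (<-trans ≤-refl j+1<j′))) j+1<j′)
  ... | refl = row-unique (diag B) (hasContent-right (diag A)) , refl

  module _ (k : ℕ) where

    plus-before-minus : ∀ {i j c i′ j′ c′} → At T (suc k) i j c → At T k i′ j′ c′ → j ≤ j′ → c ≤ c′
    plus-before-minus A B j≤j′ = content≤ (diag A) (diag B) (not-northeast A B (n≤1+n k) j≤j′) j≤j′

    -- A − strictly left of a + can only share its diagonal inside a 2-row block
    -- of k's below k+1's.
    minus-before-plus : ∀ {i j c i′ j′ c′} → At T k i j c → At T (suc k) i′ j′ c′ → j < j′ →
      c < c′ ⊎ (c ≡ c′ × j′ ≡ suc j ×
                (∃ λ c₀ → c ≡ suc c₀ × At T (suc k) (suc i) j c₀) × At T k i (suc j) (suc c))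
    minus-before-plus {i} {j} {c} {i′} {j′} {c′} A B j<j′ with i <? i′
    ... | no  i≮i′ = inj₁ (content< (diag A) (diag B) (≮⇒≥ i≮i′) j<j′)
    ... | yes i<i′ with ≤-antisym i′≤ i<i′
      where
      -- Entries grow by at least one per row and here gain only one in total.
      i′≤ : i′ ≤ suc i
      i′≤ = +-cancelˡ-≤ k i′ (suc i)
        (≤-trans (northeast A B i<i′ (<⇒≤ j<j′)) (≤-reflexive (sym (+-suc k i))))
    ...   | refl with m≤n⇒m<n∨m≡n j<j′
    ...     | inj₁ j+1<j′ = inj₁ (s≤s⁻¹ (content≤ (hasContent-right (hasContent-right (diag A)))
                  (hasContent-down (diag B)) ≤-refl j+1<j′))
    ...     | inj₂ refl = inj₂
      ( suc-injective (content-unique (hasContent-right (diag A)) (hasContent-down (diag B)))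
      , refl
      , (_ , content-unique (diag A) (hasContent-down (diag above)) , above)
      , at right (subst (λ a → T i (suc j) a ≡ true) right≡k (proj₂ (nonempty right)))
           (hasContent-right (diag A)))
      where
      up : Cell (suc i) j
      up = convex (inside A) (inside B) (n≤1+n i) ≤-refl ≤-refl (n≤1+n j)
      right : Cell i (suc j)
      right = convex (inside A) (inside B) ≤-refl (n≤1+n i) (n≤1+n j) ≤-refl
      -- The other two cells of the square are forced: the upper left one exceeds k and is at most
      -- k+1, the lower right one is at least k and below k+1.
      up≡k+1 : proj₁ (nonempty up) ≡ suc k
      up≡k+1 = ≤-antisym (row-step up (inside B) (proj₂ (nonempty up)) (entry B))
                         (col-step (inside A) up (entry A) (proj₂ (nonempty up)))
      right≡k : proj₁ (nonempty right) ≡ k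
      right≡k = ≤-antisym (s≤s⁻¹ (col-step right (inside B) (proj₂ (nonempty right)) (entry B)))
                          (row-step (inside A) right (entry A) (proj₂ (nonempty right)))
      above : At T (suc k) (suc i) j _
      above = at up (subst (λ a → T (suc i) j a ≡ true) up≡k+1 (proj₂ (nonempty up)))
                 (content-hasContent up)

    -- Column height against content height

    minusLetters plusLetters : List ℕ
    minusLetters = hword la mu T k
    plusLetters  = hword la mu T (suc k)

    D₁ D₂ : ℕ → ℤ
    D₁ = colHeight la mu T k
    D₂ = letterHeight minusLetters plusLetters

    -- On a strip both orders agree, so the occurrences of one letter form the matching that
    -- `count-inject` asks for.
    letters≤columns : ∀ a c j → (∀ {i′ j′ c′} → At T a i′ j′ c′ → c′ ≤ c → j′ ≤ j) →
                      count (_∈ᵇ hword la mu T a) c ≤ count (λ j → colHas la mu T j a) j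
    letters≤columns a c j h = count-inject {λ j → colHas la mu T j a} {_∈ᵇ hword la mu T a}
      (λ j c → ∃ λ i → At T a i j c)
      (λ {c} e → let i , j , A = hword⁻ {T} {a} {c} (∈ᵇ⇒∈ {c} {hword la mu T a} e) in j , i , A)
      (λ (_ , A) → 1≤column pla (inside A) , colHas⁺ A)
      (λ (_ , A) (_ , B) → strip-<⁻ A B) c j (λ (_ , A) → h A)

    columns≤letters : ∀ a j c → (∀ {i′ j′ c′} → At T a i′ j′ c′ → j′ ≤ j → c′ ≤ c) →
                      count (λ j → colHas la mu T j a) j ≤ count (_∈ᵇ hword la mu T a) c
    columns≤letters a j c h = count-inject {_∈ᵇ hword la mu T a} {λ j → colHas la mu T j a}
      (λ c j → ∃ λ i → At T a i j c)
      (λ {j} e → let i , c , A = colHas⁻ {T} {a} {j} e in c , i , A)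
      (λ (_ , A) → 1≤content pla (inside A) (diag A) , ∈⇒∈ᵇ {xs = hword la mu T a} (hword⁺ pla A))
      (λ (_ , A) (_ , B) → strip-< A B) j c (λ (_ , A) → h A)

    D₂≤D₁ : ∀ c j → (∀ {i′ j′ c′} → At T k i′ j′ c′ → c′ ≤ c → j′ ≤ j) →
            (∀ {i′ j′ c′} → At T (suc k) i′ j′ c′ → j′ ≤ j → c′ ≤ c) → D₂ c ℤ.≤ D₁ j
    D₂≤D₁ c j h h′ = height-mono {_∈ᵇ minusLetters} {_∈ᵇ plusLetters}
      {minusCol la mu T k} {plusCol la mu T k} {c} {j} (letters≤columns k c j h) (columns≤letters (suc k) j c h′)

    D₁≤D₂ : ∀ j c → (∀ {i′ j′ c′} → At T k i′ j′ c′ → j′ ≤ j → c′ ≤ c) →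
            (∀ {i′ j′ c′} → At T (suc k) i′ j′ c′ → c′ ≤ c → j′ ≤ j) → D₁ j ℤ.≤ D₂ c
    D₁≤D₂ j c h h′ = height-mono {minusCol la mu T k} {plusCol la mu T k}
      {_∈ᵇ minusLetters} {_∈ᵇ plusLetters} {j} {c} (columns≤letters k j c h) (letters≤columns (suc k) c j h′)

    Signed : ℕ → Set
    Signed a = a ≡ k ⊎ a ≡ suc k

    Reached : ℕ → ℕ → Set
    Reached c j = ∃ λ a → Signed a × ∃₂ λ i c′ → At T a i j c′ × c′ ≤ c

    reached? : ∀ c j → Dec (Reached c j)
    reached? c j = map′
      [ (λ (i , c′ , A) → k , inj₁ refl , i , c′ , A) , (λ (i , c′ , A) → suc k , inj₂ refl , i , c′ , A) ]′
      (λ { (_ , inj₁ refl , r) → inj₁ r ; (_ , inj₂ refl , r) → inj₂ r })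
      (low? k ⊎-dec low? (suc k))
      where
      low? : ∀ a → Dec (∃₂ λ i c′ → At T a i j c′ × c′ ≤ c)
      -- A column holds a letter at most once, so testing the one occurrence found decides the
      -- question.
      low? a with colHas la mu T j a in e
      ... | false = no λ (_ , _ , A , _) → case trans (sym e) (colHas⁺ A) of λ ()
      ... | true with i , c′ , A ← colHas⁻ {T} {a} {j} e with c′ ≤? c
      ...   | yes c′≤c = yes (i , c′ , A , c′≤c)
      ...   | no  c′≰c = no λ (_ , _ , B , c″≤c) →
                c′≰c (≤-trans (≤-reflexive (proj₂ (strip-column A B))) c″≤c)

    frontier : ∀ c n → ∃ λ j → j ≤ n × (∀ {j′} → j′ ≤ n → Reached c j′ → j′ ≤ j) ×
                               (j ≡ 0 ⊎ Reached c j)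
    frontier c zero = 0 , z≤n , (λ j≤ _ → j≤) , inj₁ refl
    frontier c (suc n) with reached? c (suc n)
    ... | yes r = suc n , ≤-refl , (λ j≤ _ → j≤) , inj₂ r
    ... | no ¬r with j , j≤n , top , low ← frontier c n = j , m≤n⇒m≤1+n j≤n , top′ , low
      where
      top′ : ∀ {j′} → j′ ≤ suc n → Reached c j′ → j′ ≤ j
      top′ j′≤ r with m≤n⇒m<n∨m≡n j′≤
      ... | inj₁ (s≤s j′≤n) = top j′≤n r
      ... | inj₂ refl       = contradiction r ¬r

    -- The witness is the rightmost column with a k or k+1 of content at most c. Every k of content
    -- at most c lies weakly left of it, and every k+1 up to that column has content at most that of
    -- the letter found there: the column prefix has no fewer - and no more +.
    dominating-column : ∀ c → ∃ λ j → j ≤ N₁ × D₂ c ℤ.≤ D₁ j ×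
      (∀ {a i′ j′ c′} → Signed a → At T a i′ j′ c′ → c′ ≤ c → j′ ≤ j) × (j ≡ 0 ⊎ Reached c j)
    dominating-column c with j , j≤N , top , low ← frontier c N₁ =
      j , j≤N , D₂≤D₁ c j (cover (inj₁ refl)) (λ A j′≤j → plus A j′≤j low) , cover , low
      where
      cover : ∀ {a i′ j′ c′} → Signed a → At T a i′ j′ c′ → c′ ≤ c → j′ ≤ j
      cover sg A c′≤c = top (column≤N₁ pla (inside A)) (_ , sg , _ , _ , A , c′≤c)
      plus : ∀ {i′ j′ c′} → At T (suc k) i′ j′ c′ → j′ ≤ j → j ≡ 0 ⊎ Reached c j → c′ ≤ c
      plus A j′≤j (inj₁ refl) = contradiction (≤-trans (1≤column pla (inside A)) j′≤j) λ ()
      plus A j′≤j (inj₂ (_ , inj₁ refl , _ , _ , B , le)) = ≤-trans (plus-before-minus A B j′≤j) le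
      plus A j′≤j (inj₂ (_ , inj₂ refl , _ , _ , B , le)) = ≤-trans (strip-≤ A B j′≤j) le

    NoPlus NoMinus : ℕ → Set
    NoPlus  j = ∀ {i c} → ¬ At T (suc k) i j c
    NoMinus j = ∀ {i c} → ¬ At T k i j c

    -- A later + could come level with this - only in a block, which has a k+1 directly above the -.
    plus-after-minus : ∀ {i j x i′ j′ c′} → At T k i j x → NoPlus j → At T (suc k) i′ j′ c′ →
                       c′ ≤ x → j′ ≤ j
    plus-after-minus A np B c′≤x = ≮⇒≥ λ j<j′ → case minus-before-plus A B j<j′ of λ where
      (inj₁ x<c′) → <⇒≱ x<c′ c′≤x
      (inj₂ (_ , _ , (_ , _ , C) , _)) → np C

    -- Columns up to j and contents up to x hold the same k's and k+1's, hence equality there.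
    -- Strictness holds because a content below x has its dominating column left of j.
    firstArgmax-letters : ∀ {i j x} → At T k i j x → NoPlus j →
                          FirstArgmax D₁ N₁ j → FirstArgmax D₂ N₂ x
    firstArgmax-letters {i} {j} {x} A np fa = firstArgmax-transfer fa (content≤N₂ pla (inside A) (diag A))
      (ℤₚ.≤-antisym
        (D₂≤D₁ x j (λ B → strip-≤⁻ B A) (λ B → plus-before-minus B A))
        (D₁≤D₂ j x (λ B → strip-≤ B A) (plus-after-minus A np)))
      λ c → let j′ , j′≤ , le , _ , low = dominating-column c in
        j′ , j′≤ , le , λ c<x → ≰⇒> λ j≤j′ → absurd c<x j≤j′ low
      where
      absurd : ∀ {c j′} → c < x → j ≤ j′ → j′ ≡ 0 ⊎ Reached c j′ → ⊥
      absurd c<x j≤j′ (inj₁ refl) = n≮0 (≤-trans (1≤column pla (inside A)) j≤j′)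
      absurd c<x j≤j′ (inj₂ (_ , inj₁ refl , _ , _ , B , le)) = <⇒≱ c<x (≤-trans (strip-≤ A B j≤j′) le)
      absurd c<x j≤j′ (inj₂ (_ , inj₂ refl , _ , _ , B , le))
        with refl ← ≤-antisym j≤j′ (plus-after-minus A np B (≤-trans le (<⇒≤ c<x))) = np B

    -- Mirror exclusion: the block would have a k directly below this +.
    minus-before-gap : ∀ {i z y i′ j′ c′} → At T (suc k) i (suc z) (suc y) → NoMinus (suc z) →
                       At T k i′ j′ c′ → j′ ≤ z → c′ ≤ y
    minus-before-gap A nm B j′≤z = case minus-before-plus B A (s≤s j′≤z) of λ where
      (inj₁ c′<y+1) → s≤s⁻¹ c′<y+1
      (inj₂ (_ , refl , _ , C)) → contradiction C nm

    -- The prefixes stop just before the selected +. Beyond y the dominating column covers that +,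
    -- so it lies beyond z.
    lastArgmax-letters : ∀ {i z y} → At T (suc k) i (suc z) (suc y) → NoMinus (suc z) →
                         LastArgmax D₁ 0 N₁ z → LastArgmax D₂ 0 N₂ y
    lastArgmax-letters {i} {z} {y} A nm la′ = lastArgmax-transfer la′ (<⇒≤ (content≤N₂ pla (inside A) (diag A)))
      (ℤₚ.≤-antisym
        (D₂≤D₁ y z (λ B c′≤y → ≮⇒≥ λ z<j′ → <⇒≱ (s≤s c′≤y) (plus-before-minus A B z<j′))
                   (λ B j′≤z → s≤s⁻¹ (strip-< B A (s≤s j′≤z))))
        (D₁≤D₂ z y (minus-before-gap A nm) (λ B c′≤y → s≤s⁻¹ (strip-<⁻ B A (s≤s c′≤y)))))
      λ c _ → let j , j≤ , le , cover , _ = dominating-column c in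
        j , j≤ , le , cover (inj₂ refl) A

    firstArgmax-zero : FirstArgmax D₁ N₁ 0 → FirstArgmax D₂ N₂ 0
    firstArgmax-zero fa = firstArgmax-transfer fa z≤n refl
      λ c → let j , j≤ , le , _ = dominating-column c in j , j≤ , le , λ ()

    lastArgmax-end : LastArgmax D₁ 0 N₁ N₁ → LastArgmax D₂ 0 N₂ N₂
    lastArgmax-end la′ = lastArgmax-transfer la′ ≤-refl
      (ℤₚ.≤-antisym (D₂≤D₁ N₂ N₁ col con) (D₁≤D₂ N₁ N₂ con col))
      λ c c≤N → let j , j≤ , le , _ = dominating-column c in
        j , j≤ , le , λ N<c → contradiction c≤N (<⇒≱ N<c)
      where
      col : ∀ {a i j c} {X : Set} → At T a i j c → X → j ≤ N₁
      col A _ = column≤N₁ pla (inside A)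
      con : ∀ {a i j c} {X : Set} → At T a i j c → X → c ≤ N₂
      con A _ = content≤N₂ pla (inside A) (diag A)

    -- Both crystals select the same cell and the same branch

    pairing-letters : Unmatched N₂ D₂ (pairing minusLetters plusLetters)
    pairing-letters = pairing-unmatched (hword-within T k) (hword-within T (suc k)) (hword-desc T (suc k))

    -- Column j and letter x come from one occurrence, or both selections fail. The absence of k+1
    -- in column j is kept because it decides the branch later.
    data Raising : Maybe ℕ → Maybe ℕ → Set where
      none : Raising nothing nothing
      some : ∀ {i j x} → At T k i j x → NoPlus j → Raising (just j) (just x)

    data Lowering : Maybe ℕ → Maybe ℕ → Set where
      none : Lowering nothing nothing
      some : ∀ {i z y} → At T (suc k) i (suc z) (suc y) → NoMinus (suc z) →
             Lowering (just (suc z)) (just (suc y))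

    not-colHas : ∀ {a j} → colHas la mu T j a ≡ false → ∀ {i c} → ¬ At T a i j c
    not-colHas e A = case trans (sym e) (colHas⁺ A) of λ ()

    raising-some : ∀ {j v} → FirstArgmax D₁ N₁ (suc j) → LastMinus D₂ N₂ v →
                   (∃₂ λ i x → At T k i (suc j) x) → NoPlus (suc j) → Raising (just (suc j)) v
    raising-some fa v (i , zero  , A) np = contradiction (1≤content pla (inside A) (diag A)) λ ()
    raising-some fa v (i , suc x , A) np = subst (Raising _)
      (lastMinus-unique (some (firstArgmax-letters A np fa)) v) (some A np)

    lowering-some : ∀ {z v} → LastArgmax D₁ 0 N₁ z → FirstPlus D₂ 0 N₂ v →
                    (∃₂ λ i y → At T (suc k) i (suc z) y) → NoMinus (suc z) → Lowering (just (suc z)) v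
    lowering-some fa v (i , zero  , A) nm = contradiction (1≤content pla (inside A) (diag A)) λ ()
    lowering-some fa v (i , suc y , A) nm = subst (Lowering _)
      (firstPlus-unique (some (content≤N₂ pla (inside A) (diag A)) (lastArgmax-letters A nm fa)) v) (some A nm)

    raising-from : ∀ {u v} → LastMinus D₁ N₁ u → LastMinus D₂ N₂ v → Raising u v
    raising-from (none fa) v = subst (Raising nothing) (lastMinus-unique (none (firstArgmax-zero fa)) v) none
    raising-from (some {j} fa) v = raising-some fa v (colHas⁻ {T} {k} {suc j} (proj₁ up)) (not-colHas (proj₂ up))
      where
      up : minusCol la mu T k (suc j) ≡ true × plusCol la mu T k (suc j) ≡ false
      up = height-up⁻ (minusCol la mu T k) (plusCol la mu T k) j (FirstArgmax.strict fa ≤-refl)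

    lowering-from : ∀ {u v} → FirstPlus D₁ 0 N₁ u → FirstPlus D₂ 0 N₂ v → Lowering u v
    lowering-from (none fa) v = subst (Lowering nothing) (firstPlus-unique (none (lastArgmax-end fa)) v) none
    lowering-from (some {z} z<N fa) v =
      lowering-some fa v (colHas⁻ {T} {suc k} {suc z} (proj₂ down)) (not-colHas (proj₁ down))
      where
      down : minusCol la mu T k (suc z) ≡ false × plusCol la mu T k (suc z) ≡ true
      down = height-down⁻ (minusCol la mu T k) (plusCol la mu T k) z (LastArgmax.strict fa ≤-refl z<N)

    raising : Raising (snd (foldl (fScan la mu T k) (0 , nothing) (columns la)))
                      (maxL (fstL (pairing minusLetters plusLetters)))
    raising = raising-from (fScan-lastMinus la mu T k) (proj₁ pairing-letters)

    lowering : Lowering (snd (foldl (eScan la mu T k) (0 , nothing) (reverse (columns la))))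
                        (minL (snd (pairing minusLetters plusLetters)))
    lowering = lowering-from (eScan-firstPlus la mu T k) (proj₂ pairing-letters)

    -- The k of content x+1 is the right neighbour of the selected one. A k+1 of that content
    -- further right would form a block with it, whose k+1 on diagonal x forms a block with the
    -- selected k in turn and so puts a k+1 into column j.
    raising-block : ∀ {i j x i₁ j₁ i₂ j₂} → At T k i j x → NoPlus j →
                    At T k i₁ j₁ (suc x) → At T (suc k) i₂ j₂ (suc x) →
                    At T k i (suc j) (suc x) × At T (suc k) i (suc j) (suc x)
    raising-block {j = j} {j₂ = j₂} A np B C with refl , refl ← strip-next A B with <-cmp j₂ (suc j)
    ... | tri< j₂≤j _ _ = contradiction (plus-before-minus C A (s≤s⁻¹ j₂≤j)) (<⇒≱ ≤-refl)
    ... | tri≈ _ refl _ with refl ← row-unique (diag C) (diag B) = B , C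
    ... | tri> _ _ j<j₂ with minus-before-plus B C j<j₂
    ...   | inj₁ lt = contradiction lt (<-irrefl refl)
    ...   | inj₂ (_ , _ , (_ , refl , E) , _) with minus-before-plus A E ≤-refl
    ...     | inj₁ lt = contradiction lt (<-irrefl refl)
    ...     | inj₂ (_ , _ , (_ , _ , F) , _) = contradiction F np

    -- Dually, a k further left on diagonal y would start two successive blocks, the second with a k
    -- in the selected column.
    lowering-block : ∀ {i z y i₁ j₁ i₂ j₂} → At T (suc k) i (suc z) (suc y) → NoMinus (suc z) →
                     At T k i₁ j₁ y → At T (suc k) i₂ j₂ y → At T k i z y × At T (suc k) i z y
    lowering-block {z = z} {j₁ = j₁} A nm C B with refl , refl ← strip-next B A with <-cmp j₁ z
    ... | tri> _ _ z<j₁ = contradiction (plus-before-minus A C z<j₁) (<⇒≱ ≤-refl)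
    ... | tri≈ _ refl _ with refl ← row-unique (diag C) (diag B) = C , B
    ... | tri< j₁<z _ _ with minus-before-plus C B j₁<z
    ...   | inj₁ lt = contradiction lt (<-irrefl refl)
    ...   | inj₂ (_ , refl , _ , E) with minus-before-plus E A ≤-refl
    ...     | inj₁ lt = contradiction lt (<-irrefl refl)
    ...     | inj₂ (_ , _ , _ , F) = contradiction F nm

-- Strictly decreasing words and list updates

desc-tail : ∀ {x xs ys} → All (x >_) xs → (∀ {c} → c ∈ x ∷ xs → c ∈ x ∷ ys) → ∀ {c} → c ∈ xs → c ∈ ys
desc-tail x> f c∈ with f (there c∈)
... | here refl = contradiction (All.lookup x> c∈) (<-irrefl refl)
... | there c∈′ = c∈′

desc-head : ∀ {x xs y ys} → All (x >_) xs → All (y >_) ys → x ∈ y ∷ ys → y ∈ x ∷ xs → x ≡ y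
desc-head _  _  (here e)   _          = e
desc-head _  _  (there x∈) (here e)   = sym e
desc-head x> y> (there x∈) (there y∈) = contradiction (All.lookup y> x∈) (<⇒≯ (All.lookup x> y∈))

-- Turns equality of residue words into a question of membership.
desc-ext : ∀ {xs ys} → AllPairs _>_ xs → AllPairs _>_ ys →
           (∀ {c} → c ∈ xs → c ∈ ys) → (∀ {c} → c ∈ ys → c ∈ xs) → xs ≡ ys
desc-ext []        []        _ _ = refl
desc-ext []        (_ ∷ _)   _ g = case g (here refl) of λ ()
desc-ext (_ ∷ _)   []        f _ = case f (here refl) of λ ()
desc-ext (x> ∷ dx) (y> ∷ dy) f g with refl ← desc-head x> y> (f (here refl)) (g (here refl)) =
  cong (_ ∷_) (desc-ext dx dy (desc-tail x> f) (desc-tail y> g))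

∈-insertDec⁻ : ∀ x ys {z} → z ∈ insertDec x ys → z ≡ x ⊎ z ∈ ys
∈-insertDec⁻ x [] (here e) = inj₁ e
∈-insertDec⁻ x (y ∷ ys) z∈ with y <ᵇ x | y ≡ᵇ x
∈-insertDec⁻ x (y ∷ ys) (here e)   | true  | _    = inj₁ e
∈-insertDec⁻ x (y ∷ ys) (there z∈) | true  | _    = inj₂ z∈
∈-insertDec⁻ x (y ∷ ys) z∈         | false | true = inj₂ z∈
∈-insertDec⁻ x (y ∷ ys) (here e)   | false | false = inj₂ (here e)
∈-insertDec⁻ x (y ∷ ys) (there z∈) | false | false with ∈-insertDec⁻ x ys z∈
... | inj₁ e   = inj₁ e
... | inj₂ z∈′ = inj₂ (there z∈′)

∈-insertDec⁺ : ∀ x ys {z} → z ≡ x ⊎ z ∈ ys → z ∈ insertDec x ys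
∈-insertDec⁺ x [] (inj₁ e) = here e
∈-insertDec⁺ x (y ∷ ys) h with y <ᵇ x | y ≡ᵇ x in e
∈-insertDec⁺ x (y ∷ ys) (inj₁ refl) | true  | _     = here refl
∈-insertDec⁺ x (y ∷ ys) (inj₂ z∈)   | true  | _     = there z∈
∈-insertDec⁺ x (y ∷ ys) (inj₁ refl) | false | true  = here (sym (≡ᵇ⇒≡ y x (≡⇒T e)))
∈-insertDec⁺ x (y ∷ ys) (inj₂ z∈)   | false | true  = z∈
∈-insertDec⁺ x (y ∷ ys) (inj₁ refl) | false | false = there (∈-insertDec⁺ x ys (inj₁ refl))
∈-insertDec⁺ x (y ∷ ys) (inj₂ (here refl)) | false | false = here refl
∈-insertDec⁺ x (y ∷ ys) (inj₂ (there z∈))  | false | false = there (∈-insertDec⁺ x ys (inj₂ z∈))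

insertDec-desc : ∀ x {ys} → AllPairs _>_ ys → AllPairs _>_ (insertDec x ys)
insertDec-desc x {[]}     _ = [] ∷ []
insertDec-desc x {y ∷ ys} (y> ∷ d) with y <ᵇ x in e₁ | y ≡ᵇ x in e₂
... | true  | _     = (y<x ∷ All.map (λ z<y → <-trans z<y y<x) y>) ∷ y> ∷ d
  where y<x = <ᵇ⇒< y x (≡⇒T e₁)
... | false | true  = y> ∷ d
... | false | false = All.tabulate (λ z∈ → [ (λ { refl → x<y }) , All.lookup y> ]′ (∈-insertDec⁻ x ys z∈))
                      ∷ insertDec-desc x d
  where
  x<y : x < y
  x<y = ≤∧≢⇒< (≮⇒≥ λ y<x → case trans (sym e₁) (T⇒≡ (<⇒<ᵇ y<x)) of λ ())
               (λ x≡y → case trans (sym e₂) (T⇒≡ (≡⇒≡ᵇ y x (sym x≡y))) of λ ())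

remove-desc : ∀ x {ys} → AllPairs _>_ ys → AllPairs _>_ (remove x ys)
remove-desc x = AllPairsₚ.filter⁺ _

setEntry-hit : ∀ T i j a v → setEntry T i j a v i j a ≡ v
setEntry-hit T i j a v rewrite T⇒≡ (≡⇒≡ᵇ i i refl) | T⇒≡ (≡⇒≡ᵇ j j refl) | T⇒≡ (≡⇒≡ᵇ a a refl) = refl

setEntry-miss : ∀ T i j a v {i′ j′ a′} → ¬ (i′ ≡ i × j′ ≡ j × a′ ≡ a) →
                setEntry T i j a v i′ j′ a′ ≡ T i′ j′ a′
setEntry-miss T i j a v {i′} {j′} {a′} ne with (i′ ≡ᵇ i) ∧ (j′ ≡ᵇ j) ∧ (a′ ≡ᵇ a) in e
... | false = refl
... | true with ei , e′ ← ∧-true⁻ {i′ ≡ᵇ i} e with ej , ea ← ∧-true⁻ {j′ ≡ᵇ j} e′ =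
  contradiction (≡ᵇ⇒≡ i′ i (≡⇒T ei) , ≡ᵇ⇒≡ j′ j (≡⇒T ej) , ≡ᵇ⇒≡ a′ a (≡⇒T ea)) ne

applyUpTo-cong : ∀ {A : Set} {f g : ℕ → A} n → (∀ t → g t ≡ f t) → applyUpTo g n ≡ applyUpTo f n
applyUpTo-cong zero    h = refl
applyUpTo-cong (suc n) h = cong₂ _∷_ (h 0) (applyUpTo-cong n (h ∘ suc))

applyUpTo-setAt : ∀ {A : Set} {f g : ℕ → A} i n → (∀ t → t ≢ i → g t ≡ f t) →
                  applyUpTo g n ≡ setAt i (g i) (applyUpTo f n)
applyUpTo-setAt i       zero    h = refl
applyUpTo-setAt zero    (suc n) h = cong (_ ∷_) (applyUpTo-cong n (λ t → h (suc t) λ ()))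
applyUpTo-setAt (suc i) (suc n) h =
  cong₂ _∷_ (h 0 λ ()) (applyUpTo-setAt i n (λ t ne → h (suc t) (ne ∘ suc-injective)))

applyUpTo-setAt₂ : ∀ {A : Set} {f g : ℕ → A} i n → (∀ t → t ≢ i → t ≢ suc i → g t ≡ f t) →
                   applyUpTo g n ≡ setAt i (g i) (setAt (suc i) (g (suc i)) (applyUpTo f n))
applyUpTo-setAt₂ i       zero    h = refl
applyUpTo-setAt₂ zero    (suc n) h =
  cong (_ ∷_) (applyUpTo-setAt 0 n (λ t ne → h (suc t) (λ ()) (ne ∘ suc-injective)))
applyUpTo-setAt₂ (suc i) (suc n) h = cong₂ _∷_ (h 0 (λ ()) (λ ()))
  (applyUpTo-setAt₂ i n (λ t ne ne′ → h (suc t) (ne ∘ suc-injective) (ne′ ∘ suc-injective)))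

nth-applyUpTo : ∀ {A : Set} (d : A) f {n t} → t < n → nth d (applyUpTo f n) t ≡ f t
nth-applyUpTo d f {suc n} {zero}  _         = refl
nth-applyUpTo d f {suc n} {suc t} (s≤s t<n) = nth-applyUpTo d (f ∘ suc) t<n

module _ (m : ℕ) (la mu : List ℕ) where

  res-nth : ∀ T {t} → t < m → nth [] (res m la mu T) t ≡ hword la mu T (suc t)
  res-nth T {t} t<m = trans (cong (λ h → nth [] h t) (map-applyUpTo suc (hword la mu T) m))
    (nth-applyUpTo [] (hword la mu T ∘ suc) t<m)

  res-setAt : ∀ T T′ t → (∀ a → a ≢ suc t → a ≢ suc (suc t) → hword la mu T′ a ≡ hword la mu T a) →
    res m la mu T′ ≡ setAt t (hword la mu T′ (suc t)) (setAt (suc t) (hword la mu T′ (suc (suc t))) (res m la mu T))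
  res-setAt T T′ t h = trans (map-applyUpTo suc (hword la mu T′) m) (trans
    (applyUpTo-setAt₂ t m (λ s ne ne′ → h (suc s) (ne ∘ suc-injective) (ne′ ∘ suc-injective)))
    (cong (λ r → setAt t (hword la mu T′ (suc t)) (setAt (suc t) (hword la mu T′ (suc (suc t))) r))
      (sym (map-applyUpTo suc (hword la mu T) m))))

  resM-if : ∀ {c c′ : Bool} {T₁ T₂ : Tableau} {h₁ h₂} → c ≡ c′ →
            (c ≡ true → res m la mu T₁ ≡ h₁) → (c ≡ false → res m la mu T₂ ≡ h₂) →
            resM m la mu (if c then just T₁ else just T₂) ≡ (if c′ then just h₁ else just h₂)
  resM-if {true}  refl f g = cong just (f refl)
  resM-if {false} refl f g = cong just (g refl)

-- The operators once their selection is known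

module _ (la mu : List ℕ) where

  fTab-nothing : ∀ k T → snd (foldl (fScan la mu T k) (0 , nothing) (columns la)) ≡ nothing →
                 fTab la mu k T ≡ nothing
  fTab-nothing k T e rewrite e = refl

  eTab-nothing : ∀ k T → snd (foldl (eScan la mu T k) (0 , nothing) (reverse (columns la))) ≡ nothing →
                 eTab la mu k T ≡ nothing
  eTab-nothing k T e rewrite e = refl

  fTab-just : ∀ k T {i j} → snd (foldl (fScan la mu T k) (0 , nothing) (columns la)) ≡ just j →
    findRow la mu T j k ≡ just i →
    fTab la mu k T ≡ (if inShapeᵇ la mu i (suc j) ∧ T i (suc j) k ∧ T i (suc j) (suc k)
      then just (setEntry (setEntry T i (suc j) k false) i j (suc k) true)
      else just (setEntry (setEntry T i j k false) i j (suc k) true))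
  fTab-just k T e e′ rewrite e | e′ = refl

  eTab-just : ∀ k T {i j} → snd (foldl (eScan la mu T k) (0 , nothing) (reverse (columns la))) ≡ just j →
    findRow la mu T j (suc k) ≡ just i →
    eTab la mu k T ≡ (if (2 ≤ᵇ j) ∧ inShapeᵇ la mu i (j ∸ 1) ∧ T i (j ∸ 1) k ∧ T i (j ∸ 1) (suc k)
      then just (setEntry (setEntry T i (j ∸ 1) (suc k) false) i j k true)
      else just (setEntry (setEntry T i j (suc k) false) i j k true))
  eTab-just k T e e′ rewrite e | e′ = refl

fStar-nothing : ∀ k h → maxL (fstL (pairing (nth [] h (k ∸ 1)) (nth [] h k))) ≡ nothing →
                fStar k h ≡ nothing
fStar-nothing k h e rewrite e = refl

eStar-nothing : ∀ k h → minL (snd (pairing (nth [] h (k ∸ 1)) (nth [] h k))) ≡ nothing →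
                eStar k h ≡ nothing
eStar-nothing k h e rewrite e = refl

fStar-just : ∀ t h {hk hk1 x} → nth [] h t ≡ hk → nth [] h (suc t) ≡ hk1 →
  maxL (fstL (pairing hk hk1)) ≡ just x →
  fStar (suc t) h ≡ (if (suc x ∈ᵇ hk) ∧ (suc x ∈ᵇ hk1)
    then just (setAt t (remove (suc x) hk) (setAt (suc t) (insertDec x hk1) h))
    else just (setAt t (remove x hk) (setAt (suc t) (insertDec x hk1) h)))
fStar-just t h refl refl e rewrite e = refl

eStar-just : ∀ t h {hk hk1 y} → nth [] h t ≡ hk → nth [] h (suc t) ≡ hk1 →
  minL (snd (pairing hk hk1)) ≡ just y →
  eStar (suc t) h ≡ (if (1 ≤ᵇ y) ∧ ((y ∸ 1) ∈ᵇ hk) ∧ ((y ∸ 1) ∈ᵇ hk1)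
    then just (setAt t (insertDec y hk) (setAt (suc t) (remove (y ∸ 1) hk1) h))
    else just (setAt t (insertDec y hk) (setAt (suc t) (remove y hk1) h)))
eStar-just t h refl refl e rewrite e = refl

-- Changing a tableau entry, and the intertwining

module Update (la mu : List ℕ) (pla : IsPartition la) (pmu : IsPartition mu)
              (m : ℕ) (T : Tableau) (svt : IsSVT m la mu T) where

  open Shape la mu
  open Strips la mu pla pmu m T svt

  -- One update serves both branches of both operators: a leaves the first cell and b enters the
  -- second, which may be equal or adjacent.
  module _ {a b i₀ j₀ x₀ i j x} (a≢b : a ≢ b) (A₀ : At T a i₀ j₀ x₀)
           (s : Cell i j) (h : HasContent i j x) where

    T₀ T′ : Tableau
    T₀ = setEntry T i₀ j₀ a false
    T′ = setEntry T₀ i j b true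

    -- A diagonal holds a at most once, so no other occurrence keeps x₀ in the word.
    hword-remove : hword la mu T′ a ≡ remove x₀ (hword la mu T a)
    hword-remove = desc-ext (hword-desc T′ a) (remove-desc x₀ (hword-desc T a)) to from
      where
      T′≡T₀ : ∀ {i′ j′} → T′ i′ j′ a ≡ T₀ i′ j′ a
      T′≡T₀ = setEntry-miss T₀ i j b true (λ (_ , _ , e) → a≢b e)

      to : ∀ {c} → c ∈ hword la mu T′ a → c ∈ remove x₀ (hword la mu T a)
      to c∈ = keep (hword⁻ {T′} {a} c∈)
        where
        keep : ∀ {c} → (∃₂ λ i′ j′ → At T′ a i′ j′ c) → c ∈ remove x₀ (hword la mu T a)
        keep {c} (i′ , j′ , at s′ t′ h′) = ∈-remove⁺ {x₀} {xs = hword la mu T a} (hword⁺ pla A) c≢x₀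
          where
          other : ¬ (i′ ≡ i₀ × j′ ≡ j₀ × a ≡ a)
          other (refl , refl , _) =
            case trans (sym (setEntry-hit T i₀ j₀ a false)) (trans (sym T′≡T₀) t′) of λ ()
          A : At T a i′ j′ c
          A = at s′ (trans (sym (setEntry-miss T i₀ j₀ a false other)) (trans (sym T′≡T₀) t′)) h′
          c≢x₀ : c ≢ x₀
          c≢x₀ refl = other (proj₁ (strip-diagonal A A₀) , proj₂ (strip-diagonal A A₀) , refl)

      from : ∀ {c} → c ∈ remove x₀ (hword la mu T a) → c ∈ hword la mu T′ a
      from c∈ = keep (hword⁻ {T} {a} (proj₁ (∈-remove⁻ {x₀} {xs = hword la mu T a} c∈)))
                     (proj₂ (∈-remove⁻ {x₀} {xs = hword la mu T a} c∈))
        where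
        keep : ∀ {c} → (∃₂ λ i′ j′ → At T a i′ j′ c) → c ≢ x₀ → c ∈ hword la mu T′ a
        keep (i′ , j′ , at s′ t′ h′) c≢x₀ = hword⁺ pla {T′} {a} (at s′ (trans T′≡T₀ (trans
          (setEntry-miss T i₀ j₀ a false λ { (refl , refl , _) → c≢x₀ (content-unique h′ (diag A₀)) }) t′)) h′)

    hword-insert : hword la mu T′ b ≡ insertDec x (hword la mu T b)
    hword-insert = desc-ext (hword-desc T′ b) (insertDec-desc x (hword-desc T b))
      (λ c∈ → ∈-insertDec⁺ x (hword la mu T b) (to (hword⁻ {T′} {b} c∈)))
      (λ c∈ → from (∈-insertDec⁻ x (hword la mu T b) c∈))
      where
      T₀≡T : ∀ {i′ j′} → T₀ i′ j′ b ≡ T i′ j′ b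
      T₀≡T = setEntry-miss T i₀ j₀ a false (λ (_ , _ , e) → a≢b (sym e))

      to : ∀ {c} → (∃₂ λ i′ j′ → At T′ b i′ j′ c) → c ≡ x ⊎ c ∈ hword la mu T b
      to (i′ , j′ , at s′ t′ h′) with i′ ≟ i | j′ ≟ j
      ... | yes refl | yes refl = inj₁ (content-unique h′ h)
      ... | no  i′≢i | _        = inj₂ (hword⁺ pla {T} {b} (at s′ (trans (sym (trans
              (setEntry-miss T₀ i j b true (i′≢i ∘ proj₁)) T₀≡T)) t′) h′))
      ... | _        | no j′≢j  = inj₂ (hword⁺ pla {T} {b} (at s′ (trans (sym (trans
              (setEntry-miss T₀ i j b true (j′≢j ∘ proj₁ ∘ proj₂)) T₀≡T)) t′) h′))

      kept : ∀ {i′ j′} → T i′ j′ b ≡ true → T′ i′ j′ b ≡ true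
      kept {i′} {j′} t with i′ ≟ i | j′ ≟ j
      ... | yes refl | yes refl = setEntry-hit T₀ i j b true
      ... | no  i′≢i | _        = trans (setEntry-miss T₀ i j b true (i′≢i ∘ proj₁)) (trans T₀≡T t)
      ... | _        | no j′≢j  = trans (setEntry-miss T₀ i j b true (j′≢j ∘ proj₁ ∘ proj₂)) (trans T₀≡T t)

      from : ∀ {c} → c ≡ x ⊎ c ∈ hword la mu T b → c ∈ hword la mu T′ b
      from (inj₁ refl) = hword⁺ pla {T′} {b} (at s (setEntry-hit T₀ i j b true) h)
      from (inj₂ c∈) = let _ , _ , at s′ t′ h′ = hword⁻ {T} {b} c∈ in hword⁺ pla {T′} {b} (at s′ (kept t′) h′)

    hword-other : ∀ d → d ≢ a → d ≢ b → hword la mu T′ d ≡ hword la mu T d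
    hword-other d d≢a d≢b = desc-ext (hword-desc T′ d) (hword-desc T d)
      (λ c∈ → let _ , _ , at s′ t′ h′ = hword⁻ {T′} {d} c∈ in hword⁺ pla {T} {d} (at s′ (trans (sym same) t′) h′))
      (λ c∈ → let _ , _ , at s′ t′ h′ = hword⁻ {T} {d} c∈ in hword⁺ pla {T′} {d} (at s′ (trans same t′) h′))
      where
      same : ∀ {i′ j′} → T′ i′ j′ d ≡ T i′ j′ d
      same = trans (setEntry-miss T₀ i j b true (λ (_ , _ , e) → d≢b e))
                   (setEntry-miss T i₀ j₀ a false (λ (_ , _ , e) → d≢a e))

  findRow-at : ∀ {a i j c} → At T a i j c → findRow la mu T j a ≡ just i
  findRow-at {a} {i} {j} A with findRow la mu T j a in e
  ... | nothing = contradiction (trans (sym (colHas⁺ A)) (findRow-nothing T a j e)) λ ()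
  ... | just i′ with _ , B ← findRow-just T a j e = cong just (proj₁ (strip-column B A))

  module _ (t : ℕ) (t+1<m : suc t < m) where

    private
      k : ℕ
      k = suc t
      h : Factorization
      h = res m la mu T
      hk≡ : nth [] h t ≡ hword la mu T k
      hk≡ = res-nth m la mu T (<-trans ≤-refl t+1<m)
      hk1≡ : nth [] h (suc t) ≡ hword la mu T (suc k)
      hk1≡ = res-nth m la mu T t+1<m
      pairing≡ : pairing (nth [] h t) (nth [] h (suc t)) ≡ pairing (hword la mu T k) (hword la mu T (suc k))
      pairing≡ = cong₂ pairing hk≡ hk1≡
      k≢k+1 : k ≢ suc k
      k≢k+1 = <⇒≢ ≤-refl

    f-update : ∀ {i₀ j₀ x₀ i j x} → At T k i₀ j₀ x₀ → Cell i j → HasContent i j x →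
      res m la mu (setEntry (setEntry T i₀ j₀ k false) i j (suc k) true) ≡
      setAt t (remove x₀ (hword la mu T k)) (setAt (suc t) (insertDec x (hword la mu T (suc k))) h)
    f-update A s hc = trans (res-setAt m la mu T _ t (hword-other k≢k+1 A s hc))
      (cong₂ (λ u v → setAt t u (setAt (suc t) v h)) (hword-remove k≢k+1 A s hc) (hword-insert k≢k+1 A s hc))

    e-update : ∀ {i₀ j₀ x₀ i j x} → At T (suc k) i₀ j₀ x₀ → Cell i j → HasContent i j x →
      res m la mu (setEntry (setEntry T i₀ j₀ (suc k) false) i j k true) ≡
      setAt t (insertDec x (hword la mu T k)) (setAt (suc t) (remove x₀ (hword la mu T (suc k))) h)
    e-update A s hc = trans (res-setAt m la mu T _ t (λ d d≢k d≢k+1 → hword-other (≢-sym k≢k+1) A s hc d d≢k+1 d≢k))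
      (cong₂ (λ u v → setAt t u (setAt (suc t) v h)) (hword-insert (≢-sym k≢k+1) A s hc)
        (hword-remove (≢-sym k≢k+1) A s hc))

    -- Naming the two computed selections u and v lets `Raising` be split; the equations tie them
    -- back.
    f-intertwines : ∀ {u v} → Raising k u v →
      snd (foldl (fScan la mu T k) (0 , nothing) (columns la)) ≡ u →
      maxL (fstL (pairing (hword la mu T k) (hword la mu T (suc k)))) ≡ v →
      resM m la mu (fTab la mu k T) ≡ fStar k h
    f-intertwines none eu ev = trans (cong (resM m la mu) (fTab-nothing la mu k T eu))
      (sym (fStar-nothing k h (trans (cong (maxL ∘ fstL) pairing≡) ev)))
    f-intertwines (some {i} {j} {x} A np) eu ev =
      trans (cong (resM m la mu) (fTab-just la mu k T eu (findRow-at A)))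
     (trans (resM-if m la mu (true⇔⇒≡ to from)
              -- The k leaves the neighbour, of content x+1, while k+1 enters the selected cell, of
              -- content x: exactly the exceptional ⋆-move.
              (λ e → f-update (proj₁ (block e)) (inside A) (diag A))
              (λ _ → f-update A (inside A) (diag A)))
       (sym (fStar-just t h hk≡ hk1≡ ev)))
      where
      block : inShapeᵇ la mu i (suc j) ∧ T i (suc j) k ∧ T i (suc j) (suc k) ≡ true →
              At T k i (suc j) (suc x) × At T (suc k) i (suc j) (suc x)
      block e with s , e′ ← ∧-true⁻ {inShapeᵇ la mu i (suc j)} e with t₁ , t₂ ← ∧-true⁻ {T i (suc j) k} e′ =
        at (inShape⇒cell s) t₁ (hasContent-right (diag A)) , at (inShape⇒cell s) t₂ (hasContent-right (diag A))
      to : inShapeᵇ la mu i (suc j) ∧ T i (suc j) k ∧ T i (suc j) (suc k) ≡ true →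
           (suc x ∈ᵇ hword la mu T k) ∧ (suc x ∈ᵇ hword la mu T (suc k)) ≡ true
      to e = ∧-true⁺ (∈⇒∈ᵇ {xs = hword la mu T k} (hword⁺ pla (proj₁ (block e))))
               (∈⇒∈ᵇ {xs = hword la mu T (suc k)} (hword⁺ pla (proj₂ (block e))))
      from : (suc x ∈ᵇ hword la mu T k) ∧ (suc x ∈ᵇ hword la mu T (suc k)) ≡ true →
             inShapeᵇ la mu i (suc j) ∧ T i (suc j) k ∧ T i (suc j) (suc k) ≡ true
      from e =
        let e₁ , e₂ = ∧-true⁻ {suc x ∈ᵇ hword la mu T k} e
            _ , _ , B = hword⁻ {T} {k} (∈ᵇ⇒∈ e₁)
            _ , _ , C = hword⁻ {T} {suc k} (∈ᵇ⇒∈ e₂)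
            B′ , C′ = raising-block k A np B C
        in ∧-true⁺ (cell⇒inShape (inside B′)) (∧-true⁺ (entry B′) (entry C′))

    e-intertwines : ∀ {u v} → Lowering k u v →
      snd (foldl (eScan la mu T k) (0 , nothing) (reverse (columns la))) ≡ u →
      minL (snd (pairing (hword la mu T k) (hword la mu T (suc k)))) ≡ v →
      resM m la mu (eTab la mu k T) ≡ eStar k h
    e-intertwines none eu ev = trans (cong (resM m la mu) (eTab-nothing la mu k T eu))
      (sym (eStar-nothing k h (trans (cong (minL ∘ snd) pairing≡) ev)))
    e-intertwines (some {i} {z} {y} A nm) eu ev =
      trans (cong (resM m la mu) (eTab-just la mu k T eu (findRow-at A)))
     (trans (resM-if m la mu (true⇔⇒≡ to from)
              (λ e → e-update (proj₂ (block e)) (inside A) (diag A))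
              (λ _ → e-update A (inside A) (diag A)))
       (sym (eStar-just t h hk≡ hk1≡ ev)))
      where
      Block Letters : Bool
      Block = (2 ≤ᵇ suc z) ∧ inShapeᵇ la mu i z ∧ T i z k ∧ T i z (suc k)
      Letters = (y ∈ᵇ hword la mu T k) ∧ (y ∈ᵇ hword la mu T (suc k))
      block : Block ≡ true → At T k i z y × At T (suc k) i z y
      block e with _ , e′ ← ∧-true⁻ {2 ≤ᵇ suc z} e with s , e″ ← ∧-true⁻ {inShapeᵇ la mu i z} e′
        with t₁ , t₂ ← ∧-true⁻ {T i z k} e″ =
        at (inShape⇒cell s) t₁ (hasContent-left (diag A)) , at (inShape⇒cell s) t₂ (hasContent-left (diag A))
      to : Block ≡ true → Letters ≡ true
      to e = ∧-true⁺ (∈⇒∈ᵇ {xs = hword la mu T k} (hword⁺ pla (proj₁ (block e))))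
               (∈⇒∈ᵇ {xs = hword la mu T (suc k)} (hword⁺ pla (proj₂ (block e))))
      from : Letters ≡ true → Block ≡ true
      from e =
        let e₁ , e₂ = ∧-true⁻ {y ∈ᵇ hword la mu T k} e
            _ , _ , B = hword⁻ {T} {k} (∈ᵇ⇒∈ e₁)
            _ , _ , C = hword⁻ {T} {suc k} (∈ᵇ⇒∈ e₂)
            B′ , C′ = lowering-block k A nm B C
        in ∧-true⁺ (T⇒≡ (≤⇒≤ᵇ (s≤s (1≤column pla (inside B′)))))
             (∧-true⁺ (cell⇒inShape (inside B′)) (∧-true⁺ (entry B′) (entry C′)))

theorem2p17 : (m : ℕ) (la mu : List ℕ) (k : ℕ) (T : Tableau) →
    2 ≤ m → IsPartition la → IsPartition mu → mu ⊆ₚ la →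
    1 ≤ k → k < m → IsSVT m la mu T →
    (resM m la mu (fTab la mu k T) ≡ fStar k (res m la mu T))
    × (resM m la mu (eTab la mu k T) ≡ eStar k (res m la mu T))
theorem2p17 m la mu (suc t) T _ pla pmu _ _ k<m svt =
  f-intertwines t k<m (raising (suc t)) refl refl , e-intertwines t k<m (lowering (suc t)) refl refl
  where
  open Strips la mu pla pmu m T svt
  open Update la mu pla pmu m T svt
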